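{- If $G\subseteq GL_n(\mathbb{R})$ is a finite subgroup that is strictly generated in codimension two, then $\mathcal{A}^G_1=\emptyset$; that is, the subspace arrangement $\mathcal A^G$ contains no hyperplane.
   Context: Let $V=\mathbb R^n$. For $g\in G$, $V^{\langle g\rangle}$ is the subspace of vectors fixed by $g$; for a subgroup $H\subset G$, $V^H$ is the subspace of vectors fixed by every element of $H$. $G$ is strictly generated in codimension two if it is generated by its elements $g$ with $\operatorname{codim}V^{\langle g\rangle}=2$. A subgroup $H\subset G$ is a stabilizer subgroup if $H=\{g\in G\mid gv=v\ \text{for all } v\in V^H\}$. The subspace arrangement of $G$ is $\mathcal A^G=\{V^H\mid \{e\}\neq H \text{ a stabilizer subgroup}\}$, and $\mathcal A^G_1$ is the set of members of $\mathcal A^G$ of codimension one. -}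

module Defs where

open import Algebra.Bundles using (CommutativeRing; Group)
open import Data.Bool.Base using (if_then_else_)
open import Data.Fin.Base using (Fin; zero; suc)
open import Data.Fin.Properties using (_≟_)
import Data.List.Relation.Unary.Enumerates.Setoid as Enumerates
open import Data.Nat.Base as ℕ using (ℕ; zero; suc)
import Data.Nat.Properties as ℕₚ
open import Data.Product.Base using (∃; Σ; _×_; _,_; proj₁; proj₂)
open import Data.Rational.Base as ℚ using (ℚ; 0ℚ; 1ℚ; ½; ∣_∣)
import Data.Rational.Properties as ℚₚ
open import Data.Rational.Solver using (module +-*-Solver)
open import Data.Vec.Functional using (Vector)
import Data.Vec.Functional.Relation.Binary.Equality.Setoid as VecEq
open import Function.Base using (_∘_)
open import Level using (0ℓ)
import Level
open import Relation.Binary.Bundles using (Setoid)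
import Relation.Binary.Construct.On as On
open import Relation.Binary.Definitions using (_Respects_)
open import Relation.Binary.PropositionalEquality as ≡ using (_≡_)
import Relation.Binary.Reasoning.Setoid as ≈-Reasoning
open import Relation.Nullary using (¬_; does)
open import Relation.Unary using (Pred; _∈_; _≐_)

-- Real numbers: Cauchy sequences of rationals, two sequences being equal
-- as reals when their difference tends to 0.  Since quotient types are not
-- available, ℝ is a setoid and "equal" always means _≃_ on reals.

IsCauchy : (ℕ → ℚ) → Set
IsCauchy x = ∀ ε → 0ℚ ℚ.< ε →
  ∃ λ N → ∀ m n → N ℕ.≤ m → N ℕ.≤ n → ∣ x m ℚ.- x n ∣ ℚ.< ε

record ℝ : Set where
  no-eta-equality
  field
    seq      : ℕ → ℚ
    isCauchy : IsCauchy seq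
open ℝ public

infix 4 _≃_
record _≃_ (x y : ℝ) : Set where
  no-eta-equality
  constructor mk≃
  field
    converge : ∀ ε → 0ℚ ℚ.< ε →
      ∃ λ N → ∀ n → N ℕ.≤ n → ∣ seq x n ℚ.- seq y n ∣ ℚ.< ε
open _≃_ public

module ℚ-Lemmas where
  half-pos : ∀ {ε} → 0ℚ ℚ.< ε → 0ℚ ℚ.< ½ ℚ.* ε
  half-pos {ε} p = ≡.subst (ℚ._< ½ ℚ.* ε) (ℚₚ.*-zeroʳ ½) (ℚₚ.*-monoʳ-<-pos ½ p)

  halves : ∀ ε → ½ ℚ.* ε ℚ.+ ½ ℚ.* ε ≡ ε
  halves ε = ≡.trans (≡.sym (ℚₚ.*-distribʳ-+ ε ½ ½)) (ℚₚ.*-identityˡ ε)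

  add-halves : ∀ {p q ε} → p ℚ.< ½ ℚ.* ε → q ℚ.< ½ ℚ.* ε → p ℚ.+ q ℚ.< ε
  add-halves {p} {q} {ε} a b = ≡.subst (p ℚ.+ q ℚ.<_) (halves ε) (ℚₚ.+-mono-< a b)

  split : ∀ {ε} p q r → p ≡ q ℚ.+ r → ∣ q ∣ ℚ.< ½ ℚ.* ε → ∣ r ∣ ℚ.< ½ ℚ.* ε → ∣ p ∣ ℚ.< ε
  split _ q r ≡.refl a b = ℚₚ.≤-<-trans (ℚₚ.∣p+q∣≤∣p∣+∣q∣ q r) (add-halves a b)

  ⊔ˡ : ∀ {M N n} → M ℕ.⊔ N ℕ.≤ n → M ℕ.≤ n
  ⊔ˡ {M} {N} = ℕₚ.≤-trans (ℕₚ.m≤m⊔n M N)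

  ⊔ʳ : ∀ {M N n} → M ℕ.⊔ N ℕ.≤ n → N ℕ.≤ n
  ⊔ʳ {M} {N} = ℕₚ.≤-trans (ℕₚ.m≤n⊔m M N)

  ∣0∣< : ∀ {p ε} → p ≡ 0ℚ → 0ℚ ℚ.< ε → ∣ p ∣ ℚ.< ε
  ∣0∣< ≡.refl ε>0 = ε>0

  ∣p-q∣≡∣q-p∣ : ∀ p q → ∣ p ℚ.- q ∣ ≡ ∣ q ℚ.- p ∣
  ∣p-q∣≡∣q-p∣ p q = ≡.trans (≡.sym (ℚₚ.∣-p∣≡∣p∣ (p ℚ.- q)))
    (≡.cong ∣_∣ (solve 2 (λ p q → :- (p :- q) := q :- p) ≡.refl p q))
    where open +-*-Solver

  shrink : ∀ B ε → 0ℚ ℚ.< B → 0ℚ ℚ.< ε →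
    ∃ λ δ → 0ℚ ℚ.< δ × B ℚ.* δ ≡ ε
  shrink B ε B>0 ε>0 = δ , δ>0 , B*δ≡ε
    where
    instance
      B⁺ : ℚ.Positive B
      B⁺ = ℚ.positive B>0
      B≢0 : ℚ.NonZero B
      B≢0 = ℚₚ.pos⇒nonZero B
      1/B⁺ : ℚ.Positive (ℚ.1/ B)
      1/B⁺ = ℚₚ.1/pos⇒pos B
    δ = ℚ.1/ B ℚ.* ε
    δ>0 = ≡.subst (ℚ._< δ) (ℚₚ.*-zeroʳ (ℚ.1/ B)) (ℚₚ.*-monoʳ-<-pos (ℚ.1/ B) ε>0)
    B*δ≡ε = ≡.trans (≡.sym (ℚₚ.*-assoc B (ℚ.1/ B) ε))
      (≡.trans (≡.cong (ℚ._* ε) (ℚₚ.*-inverseʳ B)) (ℚₚ.*-identityˡ ε))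

  0<1 : 0ℚ ℚ.< 1ℚ
  0<1 = ℚₚ.positive⁻¹ 1ℚ

  bounded : ∀ x → ∃ λ B → 0ℚ ℚ.< B ×
    ∃ λ N → ∀ n → N ℕ.≤ n → ∣ seq x n ∣ ℚ.≤ B
  bounded x = B , B>0 , N , bound
    where
    N = proj₁ (isCauchy x 1ℚ 0<1)
    close = proj₂ (isCauchy x 1ℚ 0<1)
    a = seq x N
    B = 1ℚ ℚ.+ ∣ a ∣
    B>0 = ℚₚ.+-mono-<-≤ 0<1 (ℚₚ.0≤∣p∣ a)
    bound : ∀ n → N ℕ.≤ n → ∣ seq x n ∣ ℚ.≤ B
    bound n N≤n = begin
      ∣ b ∣                   ≡⟨ ≡.cong ∣_∣ (solve 2 (λ b a → b := (b :- a) :+ a) ≡.refl b a) ⟩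
      ∣ (b ℚ.- a) ℚ.+ a ∣     ≤⟨ ℚₚ.∣p+q∣≤∣p∣+∣q∣ (b ℚ.- a) a ⟩
      ∣ b ℚ.- a ∣ ℚ.+ ∣ a ∣   ≤⟨ ℚₚ.+-monoˡ-≤ ∣ a ∣ (ℚₚ.<⇒≤ (close n N N≤n ℕₚ.≤-refl)) ⟩
      B                       ∎
      where
      b = seq x n
      open ℚₚ.≤-Reasoning
      open +-*-Solver

  scaled : ∀ {B δ ε} p q → 0ℚ ℚ.< B → B ℚ.* δ ≡ ε → ∣ p ∣ ℚ.≤ B → ∣ q ∣ ℚ.< δ → ∣ p ℚ.* q ∣ ℚ.< ε
  scaled {B} {δ} {ε} p q B>0 eq p≤B q<δ = begin-strict
    ∣ p ℚ.* q ∣       ≡⟨ ℚₚ.∣p*q∣≡∣p∣*∣q∣ p q ⟩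
    ∣ p ∣ ℚ.* ∣ q ∣   ≤⟨ ℚₚ.*-monoʳ-≤-nonNeg ∣ q ∣ {{ℚₚ.∣-∣-nonNeg q}} p≤B ⟩
    B ℚ.* ∣ q ∣       <⟨ ℚₚ.*-monoʳ-<-pos B {{ℚ.positive B>0}} q<δ ⟩
    B ℚ.* δ           ≡⟨ eq ⟩
    ε                 ∎
    where open ℚₚ.≤-Reasoning

  *-rearrange : ∀ a b c d → a ℚ.* b ℚ.- c ℚ.* d ≡ a ℚ.* (b ℚ.- d) ℚ.+ d ℚ.* (a ℚ.- c)
  *-rearrange = solve 4 (λ a b c d → a :* b :- c :* d := a :* (b :- d) :+ d :* (a :- c)) ≡.refl
    where open +-*-Solver

  +-rearrange : ∀ a b c d → (a ℚ.+ b) ℚ.- (c ℚ.+ d) ≡ (a ℚ.- c) ℚ.+ (b ℚ.- d)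
  +-rearrange = solve 4 (λ a b c d → (a :+ b) :- (c :+ d) := (a :- c) :+ (b :- d)) ≡.refl
    where open +-*-Solver

  neg-rearrange : ∀ a b → (ℚ.- a) ℚ.- (ℚ.- b) ≡ b ℚ.- a
  neg-rearrange = solve 2 (λ a b → (:- a) :- (:- b) := b :- a) ≡.refl
    where open +-*-Solver

  +-small : ∀ {ε} a b c d → ∣ a ℚ.- c ∣ ℚ.< ½ ℚ.* ε → ∣ b ℚ.- d ∣ ℚ.< ½ ℚ.* ε →
    ∣ (a ℚ.+ b) ℚ.- (c ℚ.+ d) ∣ ℚ.< ε
  +-small a b c d = split _ (a ℚ.- c) (b ℚ.- d) (+-rearrange a b c d)

  *-small : ∀ {ε} a b c d B C δ η → 0ℚ ℚ.< B → 0ℚ ℚ.< C →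
    B ℚ.* δ ≡ ½ ℚ.* ε → C ℚ.* η ≡ ½ ℚ.* ε →
    ∣ a ∣ ℚ.≤ B → ∣ d ∣ ℚ.≤ C → ∣ b ℚ.- d ∣ ℚ.< δ → ∣ a ℚ.- c ∣ ℚ.< η →
    ∣ a ℚ.* b ℚ.- c ℚ.* d ∣ ℚ.< ε
  *-small a b c d B C δ η B>0 C>0 Bδ Cη a≤B d≤C bd ac =
    split _ (a ℚ.* (b ℚ.- d)) (d ℚ.* (a ℚ.- c)) (*-rearrange a b c d)
      (scaled {B} {δ} a (b ℚ.- d) B>0 Bδ a≤B bd) (scaled {C} {η} d (a ℚ.- c) C>0 Cη d≤C ac)

  -‿congᵃ : ∀ {ε} a b → ∣ a ℚ.- b ∣ ℚ.< ε → ∣ (ℚ.- a) ℚ.- (ℚ.- b) ∣ ℚ.< ε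
  -‿congᵃ {ε} a b = ≡.subst (ℚ._< ε)
    (≡.trans (∣p-q∣≡∣q-p∣ a b) (≡.cong ∣_∣ (≡.sym (neg-rearrange a b))))

open ℚ-Lemmas

fromℚ : ℚ → ℝ
seq      (fromℚ q) _ = q
isCauchy (fromℚ q) ε ε>0 = 0 , λ _ _ _ _ → ∣0∣< (ℚₚ.+-inverseʳ q) ε>0

0ᴿ 1ᴿ : ℝ
0ᴿ = fromℚ 0ℚ
1ᴿ = fromℚ 1ℚ

infixl 6 _+ᴿ_
infixl 7 _*ᴿ_
infix  8 -ᴿ_

_+ᴿ_ : ℝ → ℝ → ℝ
seq      (x +ᴿ y) n = seq x n ℚ.+ seq y n
isCauchy (x +ᴿ y) ε ε>0 =
    let (M , p) = isCauchy x (½ ℚ.* ε) (half-pos ε>0)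
        (N , q) = isCauchy y (½ ℚ.* ε) (half-pos ε>0)
    in M ℕ.⊔ N , λ m n a b →
    +-small (seq x m) (seq y m) (seq x n) (seq y n)
      (p m n (⊔ˡ a) (⊔ˡ b)) (q m n (⊔ʳ {M} a) (⊔ʳ {M} b))

-ᴿ_ : ℝ → ℝ
seq      (-ᴿ x) n = ℚ.- seq x n
isCauchy (-ᴿ x) ε ε>0 = let (N , p) = isCauchy x ε ε>0 in
    N , λ m n a b → -‿congᵃ (seq x m) (seq x n) (p m n a b)

_*ᴿ_ : ℝ → ℝ → ℝ
seq      (x *ᴿ y) n = seq x n ℚ.* seq y n
isCauchy (x *ᴿ y) ε ε>0 =
    let (B , B>0 , K , x≤B) = bounded x
        (C , C>0 , L , y≤C) = bounded y
        (δ , δ>0 , Bδ) = shrink B (½ ℚ.* ε) B>0 (half-pos ε>0)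
        (η , η>0 , Cη) = shrink C (½ ℚ.* ε) C>0 (half-pos ε>0)
        (M , p) = isCauchy y δ δ>0
        (N , q) = isCauchy x η η>0
    in (K ℕ.⊔ L) ℕ.⊔ (M ℕ.⊔ N) , λ m n a b →
    *-small (seq x m) (seq y m) (seq x n) (seq y n) B C δ η B>0 C>0 Bδ Cη
      (x≤B m (⊔ˡ (⊔ˡ {K ℕ.⊔ L} a)))
      (y≤C n (⊔ʳ {K} (⊔ˡ {K ℕ.⊔ L} b)))
      (p m n (⊔ˡ (⊔ʳ {K ℕ.⊔ L} a)) (⊔ˡ (⊔ʳ {K ℕ.⊔ L} b)))
      (q m n (⊔ʳ {M} (⊔ʳ {K ℕ.⊔ L} a)) (⊔ʳ {M} (⊔ʳ {K ℕ.⊔ L} b)))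

module ℝ-Lemmas where
  pointwise : ∀ {x y} → (∀ n → seq x n ≡ seq y n) → x ≃ y
  pointwise {x} {y} eq = mk≃ λ ε ε>0 → 0 , λ n _ →
    ∣0∣< (≡.trans (≡.cong (ℚ._- seq y n) (eq n)) (ℚₚ.+-inverseʳ (seq y n))) ε>0

  ≃-sym : ∀ {x y} → x ≃ y → y ≃ x
  ≃-sym {x} {y} p = mk≃ λ ε ε>0 → let (N , h) = converge p ε ε>0 in
    N , λ n a → ≡.subst (ℚ._< ε) (∣p-q∣≡∣q-p∣ (seq x n) (seq y n)) (h n a)

  ≃-trans : ∀ {x y z} → x ≃ y → y ≃ z → x ≃ z
  ≃-trans {x} {y} {z} p q = mk≃ λ ε ε>0 →
    let (M , h) = converge p (½ ℚ.* ε) (half-pos ε>0)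
        (N , k) = converge q (½ ℚ.* ε) (half-pos ε>0)
    in M ℕ.⊔ N , λ n a →
         split _ (seq x n ℚ.- seq y n) (seq y n ℚ.- seq z n)
         (solve 3 (λ x y z → x :- z := (x :- y) :+ (y :- z)) ≡.refl (seq x n) (seq y n) (seq z n))
         (h n (⊔ˡ a)) (k n (⊔ʳ {M} a))
    where open +-*-Solver

  +-cong : ∀ {x y u v} → x ≃ y → u ≃ v → x +ᴿ u ≃ y +ᴿ v
  +-cong {x} {y} {u} {v} p q = mk≃ λ ε ε>0 →
    let (M , h) = converge p (½ ℚ.* ε) (half-pos ε>0)
        (N , k) = converge q (½ ℚ.* ε) (half-pos ε>0)
    in M ℕ.⊔ N , λ n a →
         +-small (seq x n) (seq u n) (seq y n) (seq v n) (h n (⊔ˡ a)) (k n (⊔ʳ {M} a))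

  -‿cong : ∀ {x y} → x ≃ y → -ᴿ x ≃ -ᴿ y
  -‿cong {x} {y} p = mk≃ λ ε ε>0 → let (N , h) = converge p ε ε>0 in
    N , λ n a → -‿congᵃ (seq x n) (seq y n) (h n a)

  *-cong : ∀ {x y u v} → x ≃ y → u ≃ v → x *ᴿ u ≃ y *ᴿ v
  *-cong {x} {y} {u} {v} p q = mk≃ λ ε ε>0 →
    let (B , B>0 , K , x≤B) = bounded x
        (C , C>0 , L , v≤C) = bounded v
        (δ , δ>0 , Bδ) = shrink B (½ ℚ.* ε) B>0 (half-pos ε>0)
        (η , η>0 , Cη) = shrink C (½ ℚ.* ε) C>0 (half-pos ε>0)
        (M , h) = converge q δ δ>0
        (N , k) = converge p η η>0
    in (K ℕ.⊔ L) ℕ.⊔ (M ℕ.⊔ N) , λ n a →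
      *-small (seq x n) (seq u n) (seq y n) (seq v n) B C δ η B>0 C>0 Bδ Cη
        (x≤B n (⊔ˡ (⊔ˡ {K ℕ.⊔ L} a)))
        (v≤C n (⊔ʳ {K} (⊔ˡ {K ℕ.⊔ L} a)))
        (h n (⊔ˡ (⊔ʳ {K ℕ.⊔ L} a)))
        (k n (⊔ʳ {M} (⊔ʳ {K ℕ.⊔ L} a)))

open ℝ-Lemmas

ℝ-commutativeRing : CommutativeRing 0ℓ 0ℓ
ℝ-commutativeRing = record
  { Carrier = ℝ
  ; _≈_ = _≃_
  ; _+_ = _+ᴿ_
  ; _*_ = _*ᴿ_
  ; -_  = -ᴿ_
  ; 0#  = 0ᴿ
  ; 1#  = 1ᴿ
  ; isCommutativeRing = record
    { isRing = record
      { +-isAbelianGroup = record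
        { isGroup = record
          { isMonoid = record
            { isSemigroup = record
              { isMagma = record
                { isEquivalence = record
                  { refl = pointwise λ _ → ≡.refl ; sym = ≃-sym ; trans = ≃-trans }
                ; ∙-cong = +-cong
                }
              ; assoc = λ x y z → pointwise λ n → ℚₚ.+-assoc (seq x n) (seq y n) (seq z n)
              }
            ; identity = (λ x → pointwise λ n → ℚₚ.+-identityˡ (seq x n))
                       , (λ x → pointwise λ n → ℚₚ.+-identityʳ (seq x n))
            }
          ; inverse = (λ x → pointwise λ n → ℚₚ.+-inverseˡ (seq x n))
                    , (λ x → pointwise λ n → ℚₚ.+-inverseʳ (seq x n))
          ; ⁻¹-cong = -‿cong
          }
        ; comm = λ x y → pointwise λ n → ℚₚ.+-comm (seq x n) (seq y n)
        }
      ; *-cong = *-cong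
      ; *-assoc = λ x y z → pointwise λ n → ℚₚ.*-assoc (seq x n) (seq y n) (seq z n)
      ; *-identity = (λ x → pointwise λ n → ℚₚ.*-identityˡ (seq x n))
                   , (λ x → pointwise λ n → ℚₚ.*-identityʳ (seq x n))
      ; distrib = (λ x y z → pointwise λ n → ℚₚ.*-distribˡ-+ (seq x n) (seq y n) (seq z n))
                , (λ x y z → pointwise λ n → ℚₚ.*-distribʳ-+ (seq x n) (seq y n) (seq z n))
      }
    ; *-comm = λ x y → pointwise λ n → ℚₚ.*-comm (seq x n) (seq y n)
    }
  }

private module R = CommutativeRing ℝ-commutativeRing
open import Algebra.Properties.Semiring.Sum R.semiring
  using (sum; sum-syntax; sum-cong-≋; sum-replicate-zero; ∑-comm; ∑-distrib-+; *-distribˡ-sum; *-distribʳ-sum)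
open VecEq R.setoid using (_≋_; ≋-refl; ≋-sym; ≋-trans) public

infixl 6 _+ⱽ_
infixr 7 _*ⱽ_

0ⱽ : ∀ {n} → Vector ℝ n
0ⱽ _ = 0ᴿ

_+ⱽ_ : ∀ {n} → Vector ℝ n → Vector ℝ n → Vector ℝ n
(v +ⱽ w) i = v i +ᴿ w i

_*ⱽ_ : ∀ {n} → ℝ → Vector ℝ n → Vector ℝ n
(a *ⱽ v) i = a *ᴿ v i

Matrix : ℕ → Set
Matrix n = Fin n → Fin n → ℝ

infix 4 _≃ᴹ_
_≃ᴹ_ : ∀ {n} → Matrix n → Matrix n → Set
A ≃ᴹ B = ∀ i → A i ≋ B i

1ᴹ : ∀ {n} → Matrix n
1ᴹ i j = if does (i ≟ j) then 1ᴿ else 0ᴿ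

infixl 7 _*ᴹ_
_*ᴹ_ : ∀ {n} → Matrix n → Matrix n → Matrix n
_*ᴹ_ {n} A B i k = ∑[ j < n ] (A i j *ᴿ B j k)

infixr 7 _·_
_·_ : ∀ {n} → Matrix n → Vector ℝ n → Vector ℝ n
_·_ {n} A v i = ∑[ j < n ] (A i j *ᴿ v j)

module Matrix-Lemmas where
  sum-zero : ∀ {m} {f : Vector ℝ m} → (∀ i → f i ≃ 0ᴿ) → sum f ≃ 0ᴿ
  sum-zero {m} f≃0 = R.trans (sum-cong-≋ f≃0) (sum-replicate-zero m)

  1ᴹ·-identity : ∀ {n} (v : Vector ℝ n) i → ∑[ j < n ] (1ᴹ i j *ᴿ v j) ≃ v i
  1ᴹ·-identity {suc n} v zero =
    R.trans (R.+-cong (R.*-identityˡ (v zero)) (sum-zero λ j → R.zeroˡ (v (suc j)))) (R.+-identityʳ (v zero))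
  1ᴹ·-identity {suc n} v (suc i) =
    R.trans (R.+-cong (R.zeroˡ (v zero)) (1ᴹ·-identity (v ∘ suc) i)) (R.+-identityˡ (v (suc i)))

  ·1ᴹ-identity : ∀ {n} (v : Vector ℝ n) i → ∑[ j < n ] (v j *ᴿ 1ᴹ j i) ≃ v i
  ·1ᴹ-identity {suc n} v zero =
    R.trans (R.+-cong (R.*-identityʳ (v zero)) (sum-zero λ j → R.zeroʳ (v (suc j)))) (R.+-identityʳ (v zero))
  ·1ᴹ-identity {suc n} v (suc i) =
    R.trans (R.+-cong (R.zeroʳ (v zero)) (·1ᴹ-identity (v ∘ suc) i)) (R.+-identityˡ (v (suc i)))

  sum-assoc : ∀ {n} (u : Vector ℝ n) (B : Matrix n) (w : Vector ℝ n) →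
    ∑[ j < n ] (∑[ k < n ] (u k *ᴿ B k j) *ᴿ w j) ≃ ∑[ k < n ] (u k *ᴿ ∑[ j < n ] (B k j *ᴿ w j))
  sum-assoc {n} u B w = begin
    ∑[ j < n ] (∑[ k < n ] (u k *ᴿ B k j) *ᴿ w j)      ≈⟨ sum-cong-≋ (λ j → *-distribʳ-sum (w j) (λ k → u k *ᴿ B k j)) ⟩
    ∑[ j < n ] ∑[ k < n ] (u k *ᴿ B k j *ᴿ w j)        ≈⟨ ∑-comm (λ j k → u k *ᴿ B k j *ᴿ w j) ⟩
    ∑[ k < n ] ∑[ j < n ] (u k *ᴿ B k j *ᴿ w j)        ≈⟨ sum-cong-≋ (λ k → sum-cong-≋ (λ j → R.*-assoc (u k) (B k j) (w j))) ⟩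
    ∑[ k < n ] ∑[ j < n ] (u k *ᴿ (B k j *ᴿ w j))      ≈⟨ sum-cong-≋ (λ k → *-distribˡ-sum (u k) (λ j → B k j *ᴿ w j)) ⟨
    ∑[ k < n ] (u k *ᴿ ∑[ j < n ] (B k j *ᴿ w j))      ∎
    where open ≈-Reasoning R.setoid

  *ᴹ-cong : ∀ {n} {A B C D : Matrix n} → A ≃ᴹ B → C ≃ᴹ D → A *ᴹ C ≃ᴹ B *ᴹ D
  *ᴹ-cong p q i k = sum-cong-≋ λ j → R.*-cong (p i j) (q j k)

  *ᴹ-assoc : ∀ {n} (A B C : Matrix n) → (A *ᴹ B) *ᴹ C ≃ᴹ A *ᴹ (B *ᴹ C)
  *ᴹ-assoc A B C i l = sum-assoc (A i) B (λ j → C j l)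

  *ᴹ-identityˡ : ∀ {n} (A : Matrix n) → 1ᴹ *ᴹ A ≃ᴹ A
  *ᴹ-identityˡ A i k = 1ᴹ·-identity (λ j → A j k) i

  *ᴹ-identityʳ : ∀ {n} (A : Matrix n) → A *ᴹ 1ᴹ ≃ᴹ A
  *ᴹ-identityʳ A i k = ·1ᴹ-identity (A i) k

open Matrix-Lemmas

matrixSetoid : ℕ → Setoid 0ℓ 0ℓ
matrixSetoid n = record
  { Carrier = Matrix n
  ; _≈_ = _≃ᴹ_
  ; isEquivalence = record
    { refl  = λ i → ≋-refl
    ; sym   = λ p i → ≋-sym (p i)
    ; trans = λ p q i → ≋-trans (p i) (q i)
    }
  }

record GL (n : ℕ) : Set where
  field
    mat      : Matrix n
    inv      : Matrix n
    inverseˡ : inv *ᴹ mat ≃ᴹ 1ᴹ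
    inverseʳ : mat *ᴹ inv ≃ᴹ 1ᴹ
open GL public

module Inverse-Lemmas where
  inverse-unique : ∀ {n} {A B C : Matrix n} → B *ᴹ A ≃ᴹ 1ᴹ → A *ᴹ C ≃ᴹ 1ᴹ → B ≃ᴹ C
  inverse-unique {n} {A} {B} {C} BA AC = begin
    B              ≈⟨ *ᴹ-identityʳ B ⟨
    B *ᴹ 1ᴹ        ≈⟨ *ᴹ-cong {A = B} {B} {A *ᴹ C} {1ᴹ} refl AC ⟨
    B *ᴹ (A *ᴹ C)  ≈⟨ *ᴹ-assoc B A C ⟨
    (B *ᴹ A) *ᴹ C  ≈⟨ *ᴹ-cong {A = B *ᴹ A} {1ᴹ} {C} {C} BA refl ⟩
    1ᴹ *ᴹ C        ≈⟨ *ᴹ-identityˡ C ⟩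
    C              ∎
    where
    open ≈-Reasoning (matrixSetoid n)
    open Setoid (matrixSetoid n) using (refl)

  cancel-middle : ∀ {n} {A B C D : Matrix n} → B *ᴹ C ≃ᴹ 1ᴹ → A *ᴹ D ≃ᴹ 1ᴹ →
    (A *ᴹ B) *ᴹ (C *ᴹ D) ≃ᴹ 1ᴹ
  cancel-middle {n} {A} {B} {C} {D} BC AD = begin
    (A *ᴹ B) *ᴹ (C *ᴹ D)   ≈⟨ *ᴹ-assoc A B (C *ᴹ D) ⟩
    A *ᴹ (B *ᴹ (C *ᴹ D))   ≈⟨ *ᴹ-cong {A = A} {A} refl (*ᴹ-assoc B C D) ⟨
    A *ᴹ ((B *ᴹ C) *ᴹ D)   ≈⟨ *ᴹ-cong {A = A} {A} refl (*ᴹ-cong {A = B *ᴹ C} {1ᴹ} {D} {D} BC refl) ⟩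
    A *ᴹ (1ᴹ *ᴹ D)         ≈⟨ *ᴹ-cong {A = A} {A} refl (*ᴹ-identityˡ D) ⟩
    A *ᴹ D                 ≈⟨ AD ⟩
    1ᴹ                     ∎
    where
    open ≈-Reasoning (matrixSetoid n)
    open Setoid (matrixSetoid n) using (refl)

open Inverse-Lemmas

-- Elements of GLₙ(ℝ) are compared through their matrices only; the stored
-- inverse is determined by the matrix.
GL-group : ℕ → Group 0ℓ 0ℓ
GL-group n = record
  { Carrier = GL n
  ; _≈_ = λ g h → mat g ≃ᴹ mat h
  ; _∙_ = λ g h → record
    { mat = mat g *ᴹ mat h
    ; inv = inv h *ᴹ inv g
    ; inverseˡ = cancel-middle {A = inv h} {inv g} {mat g} {mat h} (inverseˡ g) (inverseˡ h)
    ; inverseʳ = cancel-middle {A = mat g} {mat h} {inv h} {inv g} (inverseʳ h) (inverseʳ g)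
    }
  ; ε = record
    { mat = 1ᴹ ; inv = 1ᴹ ; inverseˡ = *ᴹ-identityˡ 1ᴹ ; inverseʳ = *ᴹ-identityˡ 1ᴹ }
  ; _⁻¹ = λ g → record
    { mat = inv g ; inv = mat g ; inverseˡ = inverseʳ g ; inverseʳ = inverseˡ g }
  ; isGroup = record
    { isMonoid = record
      { isSemigroup = record
        { isMagma = record
          { isEquivalence = On.isEquivalence mat (Setoid.isEquivalence (matrixSetoid n))
          ; ∙-cong = λ {g} {h} {k} {l} → *ᴹ-cong {A = mat g} {mat h} {mat k} {mat l}
          }
        ; assoc = λ g h k → *ᴹ-assoc (mat g) (mat h) (mat k)
        }
      ; identity = (λ g → *ᴹ-identityˡ (mat g)) , (λ g → *ᴹ-identityʳ (mat g))
      }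
    ; inverse = inverseˡ , inverseʳ
    ; ⁻¹-cong = λ {g} {h} p → inverse-unique {A = mat g} {inv g} {inv h} (inverseˡ g)
        (Setoid.trans (matrixSetoid n) (*ᴹ-cong {A = mat g} {mat h} {inv h} {inv h} p (λ i → ≋-refl)) (inverseʳ h))
    }
  }

module _ (Γ : Group 0ℓ 0ℓ) where
  open Group Γ

  record Subgroup : Set₁ where
    field
      ⟦_⟧ᴳ     : Pred Carrier 0ℓ
      resp     : ⟦_⟧ᴳ Respects _≈_
      ε-closed : ε ∈ ⟦_⟧ᴳ
      ∙-closed : ∀ {g h} → g ∈ ⟦_⟧ᴳ → h ∈ ⟦_⟧ᴳ → g ∙ h ∈ ⟦_⟧ᴳ
      ⁻¹-closed : ∀ {g} → g ∈ ⟦_⟧ᴳ → g ⁻¹ ∈ ⟦_⟧ᴳ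

  data Generated (S : Pred Carrier 0ℓ) : Pred Carrier 0ℓ where
    ∈-gen  : ∀ {g} → g ∈ S → g ∈ Generated S
    ε-gen  : ε ∈ Generated S
    ∙-gen  : ∀ {g h} → g ∈ Generated S → h ∈ Generated S → g ∙ h ∈ Generated S
    ⁻¹-gen : ∀ {g} → g ∈ Generated S → g ⁻¹ ∈ Generated S
    ≈-gen  : ∀ {g h} → g ≈ h → g ∈ Generated S → h ∈ Generated S

open Subgroup public using (⟦_⟧ᴳ)

module _ {Γ : Group 0ℓ 0ℓ} where
  open Group Γ

  subgroupSetoid : Subgroup Γ → Setoid 0ℓ 0ℓ
  subgroupSetoid G = On.setoid {B = Σ Carrier ⟦ G ⟧ᴳ} setoid proj₁

  -- The list may contain repetitions, so equality in G need not be decidable.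
  IsFinite : Subgroup Γ → Set
  IsFinite G = ∃ λ xs → Enumerates.IsEnumeration (subgroupSetoid G) xs

  IsTrivial : Subgroup Γ → Set
  IsTrivial H = ⟦ H ⟧ᴳ ≐ (_≈ ε)

record Subspace (n : ℕ) : Set₁ where
  field
    ⟦_⟧ⱽ     : Pred (Vector ℝ n) 0ℓ
    resp     : ⟦_⟧ⱽ Respects _≋_
    0-closed : 0ⱽ ∈ ⟦_⟧ⱽ
    +-closed : ∀ {v w} → v ∈ ⟦_⟧ⱽ → w ∈ ⟦_⟧ⱽ → v +ⱽ w ∈ ⟦_⟧ⱽ
    *-closed : ∀ a {v} → v ∈ ⟦_⟧ⱽ → a *ⱽ v ∈ ⟦_⟧ⱽ
open Subspace public using (⟦_⟧ⱽ)

linComb : ∀ {n k} → Vector ℝ k → Vector (Vector ℝ n) k → Vector ℝ n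
linComb {k = k} c b i = ∑[ j < k ] (c j *ᴿ b j i)

record IsBasis {n k : ℕ} (W : Subspace n) (b : Vector (Vector ℝ n) k) : Set where
  field
    member      : ∀ j → b j ∈ ⟦ W ⟧ⱽ
    independent : ∀ c → linComb c b ≋ 0ⱽ → c ≋ 0ⱽ
    spanning    : ∀ {v} → v ∈ ⟦ W ⟧ⱽ → ∃ λ c → v ≋ linComb c b

HasDim : ∀ {n} → Subspace n → ℕ → Set
HasDim {n} W k = ∃ λ (b : Vector (Vector ℝ n) k) → IsBasis W b

-- codim W = n − dim W, written additively to avoid truncated subtraction.
HasCodim : ∀ {n} → Subspace n → ℕ → Set
HasCodim {n} W c = ∃ λ k → HasDim W k × k ℕ.+ c ≡ n

module Action-Lemmas where
  ·-cong : ∀ {n} (A : Matrix n) {v w} → v ≋ w → A · v ≋ A · w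
  ·-cong A p i = sum-cong-≋ λ j → R.*-congˡ (p j)

  ·-zero : ∀ {n} (A : Matrix n) → A · 0ⱽ ≋ 0ⱽ
  ·-zero {n} A i = sum-zero λ j → R.zeroʳ (A i j)

  ·-+ : ∀ {n} (A : Matrix n) v w → A · (v +ⱽ w) ≋ (A · v) +ⱽ (A · w)
  ·-+ A v w i = R.trans (sum-cong-≋ λ j → R.distribˡ (A i j) (v j) (w j))
    (∑-distrib-+ (λ j → A i j *ᴿ v j) (λ j → A i j *ᴿ w j))

  ·-* : ∀ {n} (A : Matrix n) a v → A · (a *ⱽ v) ≋ a *ⱽ (A · v)
  ·-* A a v i = R.trans (sum-cong-≋ λ j → swap (A i j) a (v j))
    (R.sym (*-distribˡ-sum a (λ j → A i j *ᴿ v j)))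
    where
    swap : ∀ x y z → x *ᴿ (y *ᴿ z) ≃ y *ᴿ (x *ᴿ z)
    swap x y z = R.trans (R.sym (R.*-assoc x y z))
      (R.trans (R.*-congʳ (R.*-comm x y)) (R.*-assoc y x z))

open Action-Lemmas

Fixes : ∀ {n} → GL n → Vector ℝ n → Set
Fixes g v = mat g · v ≋ v

V^⟨_⟩ : ∀ {n} → GL n → Subspace n
V^⟨ g ⟩ = record
  { ⟦_⟧ⱽ     = Fixes g
  ; resp     = λ v≋w p → ≋-trans (·-cong (mat g) (≋-sym v≋w)) (≋-trans p v≋w)
  ; 0-closed = ·-zero (mat g)
  ; +-closed = λ {v} {w} p q → ≋-trans (·-+ (mat g) v w) λ i → R.+-cong (p i) (q i)
  ; *-closed = λ a {v} p → ≋-trans (·-* (mat g) a v) λ i → R.*-congˡ (p i)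
  }

V^_ : ∀ {n} → Subgroup (GL-group n) → Subspace n
V^ H = record
  { ⟦_⟧ⱽ     = λ v → ∀ g → g ∈ ⟦ H ⟧ᴳ → Fixes g v
  ; resp     = λ v≋w p g g∈H → Subspace.resp V^⟨ g ⟩ v≋w (p g g∈H)
  ; 0-closed = λ g _ → Subspace.0-closed V^⟨ g ⟩
  ; +-closed = λ p q g g∈H → Subspace.+-closed V^⟨ g ⟩ (p g g∈H) (q g g∈H)
  ; *-closed = λ a p g g∈H → Subspace.*-closed V^⟨ g ⟩ a (p g g∈H)
  }

module _ {n : ℕ} (G : Subgroup (GL-group n)) where

  StrictlyGeneratedInCodim2 : Set
  StrictlyGeneratedInCodim2 =
    ⟦ G ⟧ᴳ ≐ Generated (GL-group n) (λ g → g ∈ ⟦ G ⟧ᴳ × HasCodim V^⟨ g ⟩ 2)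

  IsStabilizer : Subgroup (GL-group n) → Set
  IsStabilizer H =
    ⟦ H ⟧ᴳ ≐ (λ g → g ∈ ⟦ G ⟧ᴳ × (∀ v → v ∈ ⟦ V^ H ⟧ⱽ → Fixes g v))

  -- The inclusion H ⊆ G is part of being a stabilizer.
  𝒜 : Pred (Subspace n) (Level.suc 0ℓ)
  𝒜 W = ∃ λ H → IsStabilizer H × ¬ IsTrivial H × ⟦ W ⟧ⱽ ≐ ⟦ V^ H ⟧ⱽ

  𝒜₁ : Pred (Subspace n) (Level.suc 0ℓ)
  𝒜₁ W = W ∈ 𝒜 × HasCodim W 1

{-# OPTIONS --safe #-}

-- Every element g of the finite group G has determinant 1: if V^⟨g⟩ has codimension two, then g acts on V/V^⟨g⟩
-- by a 2×2 matrix M with det M = det g = ±1.  If det M were −1, then M − M⁻¹ would be the scalar tr M, which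
-- invariance of a g-invariant inner product forces to be 0, so g² = 1 and M = −1, whence det M = 1 after all.
-- An element h of G fixing a hyperplane pointwise acts on the quotient line by det h = 1, so it is unipotent of
-- finite order, that is, h = 1; hence a stabilizer subgroup H with codim V^H = 1 is trivial.
--
-- Equality of reals is ¬¬-stable, so bases may be completed and cases distinguished under a double negation.

module Submission where

open import Defs
open import Algebra.Bundles using (CommutativeRing; Group)
import Algebra.Properties.Semiring.Exp as Exp
import Algebra.Properties.Semiring.Sum as Sum
import Algebra.Solver.Ring as RingSolver
open import Algebra.Solver.Ring.AlmostCommutativeRing
  using (AlmostCommutativeRing; fromCommutativeRing; _-Raw-AlmostCommutative⟶_)
open import Data.Empty using (⊥-elim)
open import Data.Fin.Base using (Fin; zero; suc; toℕ; punchIn; punchOut)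
open import Data.Fin.Properties using (_≟_; pigeonhole; punchInᵢ≢i; punchIn-injective; punchIn-punchOut)
import Data.List.Base as List
import Data.List.Relation.Unary.Any as Any
open import Data.List.Relation.Unary.Any.Properties using (lookup-index)
open import Data.Maybe.Base as Maybe using (Maybe)
open import Data.Nat.Base as ℕ using (ℕ; zero; suc)
import Data.Nat.Properties as ℕₚ
open import Data.Product.Base using (∃; Σ; _×_; _,_; proj₁; proj₂)
open import Data.Rational.Base as ℚ using (ℚ; 0ℚ; 1ℚ; ½; ∣_∣)
import Data.Rational.Properties as ℚₚ
open import Data.Rational.Solver using (module +-*-Solver)
open import Data.Sum.Base using (_⊎_; inj₁; inj₂)
open import Data.Vec.Functional using (Vector; _∷_; tail; updateAt)
open import Data.Vec.Functional.Properties
  using (updateAt-updates; updateAt-minimal; updateAt-id-local; updateAt-commutes; map-updateAt)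
open import Function.Base using (_∘_; const; _$_; id)
open import Relation.Binary.PropositionalEquality as ≡ using (_≡_; _≢_)
import Relation.Binary.Reasoning.Setoid as ≈-Reasoning
open import Relation.Nullary using (¬_; yes; no)
open import Relation.Nullary.Decidable using (dec⇒maybe)
open import Relation.Unary using (_∈_; Empty)

-- Division is the obstacle. A real known only not to equal zero yields no inverse, so a basis whose
-- volume is nonzero in that sense gives no coordinates. Cramer's rule supplies them multiplied by
-- `δ = volume basis`; hence the relations `δ *ⱽ A · u ≋ ...` and the powers of `δ`, which
-- `*-cancelˡ` removes. Quotient spaces are avoided too. The map A - 1 kills the fixed vectors, so
-- its values (`displacement`) carry the action of M on the quotient inside V itself, where the
-- inner product is at hand. The trace of M vanishes because A - A⁻¹ is skew for an invariant form,
-- and a skew scalar is zero. The determinant is ±1 because a real root of unity d satisfies (d² -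
-- 1)(1 + d² + d⁴ + ...) = 0, where the second factor is at least 1.

private module R = CommutativeRing ℝ-commutativeRing
open Exp R.semiring using (_^_)
open Sum R.semiring using (sum; sum-syntax; sum-cong-≋; ∑-distrib-+; *-distribˡ-sum)
open ℚ-Lemmas
open ℝ-Lemmas using (pointwise)
open Matrix-Lemmas
open Action-Lemmas

-- Real numbers

-- Coefficients are rational because the ring solver has to compare them, and equality of reals is
-- not decidable.
ℚ-coefficients : AlmostCommutativeRing.rawRing (fromCommutativeRing ℚₚ.+-*-commutativeRing)
  -Raw-AlmostCommutative⟶ fromCommutativeRing ℝ-commutativeRing
ℚ-coefficients = record
  { ⟦_⟧    = fromℚ
  ; +-homo = λ _ _ → pointwise λ _ → ≡.refl
  ; *-homo = λ _ _ → pointwise λ _ → ≡.refl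
  ; -‿homo = λ _ → pointwise λ _ → ≡.refl
  ; 0-homo = R.refl
  ; 1-homo = R.refl
  }

fromℚ-≟ : ∀ p q → Maybe (fromℚ p ≃ fromℚ q)
fromℚ-≟ p q = Maybe.map (λ { ≡.refl → R.refl }) (dec⇒maybe (p ℚₚ.≟ q))

module ℝ-Solver = RingSolver _ _ ℚ-coefficients fromℚ-≟
open ℝ-Solver using (solve; con; _:+_; _:*_; :-_; _:-_; _:=_)

-- The positive form of being nonzero: its lower bounds can be multiplied, whereas a mere negation
-- carries no bound.
Apart : ℝ → Set
Apart x = ∃ λ ε → 0ℚ ℚ.< ε × ∃ λ N → ∀ n → N ℕ.≤ n → ε ℚ.≤ ∣ seq x n ∣

p-0≡p : ∀ p → p ℚ.- 0ℚ ≡ p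
p-0≡p = ℚₚ.+-identityʳ

≃0-intro : ∀ {x} → (∀ ε → 0ℚ ℚ.< ε → ∃ λ N → ∀ n → N ℕ.≤ n → ∣ seq x n ∣ ℚ.< ε) → x ≃ 0ᴿ
≃0-intro {x} h = mk≃ λ ε ε>0 → let (N , k) = h ε ε>0 in
  N , λ n N≤n → ≡.subst (λ q → ∣ q ∣ ℚ.< ε) (≡.sym (p-0≡p (seq x n))) (k n N≤n)

Apart⇒≄0 : ∀ {x} → Apart x → ¬ x ≃ 0ᴿ
Apart⇒≄0 {x} (ε , ε>0 , M , h) p =
  let (N , k) = converge p ε ε>0
      n = M ℕ.⊔ N
      ∣x∣<ε = ≡.subst (λ q → ∣ q ∣ ℚ.< ε) (p-0≡p (seq x n)) (k n (ℕₚ.m≤n⊔m M N))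
  in ℚₚ.<-irrefl ≡.refl (ℚₚ.≤-<-trans (h n (ℕₚ.m≤m⊔n M N)) ∣x∣<ε)

-- A rational comparison at a single index N decides matters. With Cauchy modulus ε/4, either |x_N|
-- < ε/2 and the tail stays below ε, or the tail stays above ε/4, which is excluded. All stability
-- of equality rests on this.
¬Apart⇒≃0 : ∀ {x} → ¬ Apart x → x ≃ 0ᴿ
¬Apart⇒≃0 {x} ¬apart = ≃0-intro small
  where
  small : ∀ ε → 0ℚ ℚ.< ε → ∃ λ N → ∀ n → N ℕ.≤ n → ∣ seq x n ∣ ℚ.< ε
  small ε ε>0 with isCauchy x (½ ℚ.* (½ ℚ.* ε)) (half-pos (half-pos ε>0))
  ... | N , close with ∣ seq x N ∣ ℚₚ.<? ½ ℚ.* ε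
  ... | yes a<½ε = N , λ n N≤n →
    split (seq x n) (seq x n ℚ.- seq x N) (seq x N)
      (S.solve 2 (λ p q → p S.:= (p S.:- q) S.:+ q) ≡.refl (seq x n) (seq x N))
      (ℚₚ.<-trans (close n N N≤n ℕₚ.≤-refl) (half< (half-pos ε>0))) a<½ε
    where
    module S = +-*-Solver
    half< : ∀ {δ} → 0ℚ ℚ.< δ → ½ ℚ.* δ ℚ.< δ
    half< {δ} δ>0 = ≡.subst₂ ℚ._<_ (ℚₚ.+-identityʳ (½ ℚ.* δ)) (halves δ)
      (ℚₚ.+-monoʳ-< (½ ℚ.* δ) (half-pos δ>0))
  ... | no a≮½ε = ⊥-elim (¬apart (δ , half-pos (half-pos ε>0) , N , bound))
    where
    module S = +-*-Solver
    δ = ½ ℚ.* (½ ℚ.* ε)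
    bound : ∀ n → N ℕ.≤ n → δ ℚ.≤ ∣ seq x n ∣
    bound n N≤n with δ ℚₚ.≤? ∣ seq x n ∣
    ... | yes p = p
    ... | no q = ⊥-elim (a≮½ε (split (seq x N) (seq x n) (seq x N ℚ.- seq x n)
            (S.solve 2 (λ p q → p S.:= q S.:+ (p S.:- q)) ≡.refl (seq x N) (seq x n))
            (ℚₚ.≰⇒> q) (close N n ℕₚ.≤-refl N≤n)))

1≄0 : ¬ 1ᴿ ≃ 0ᴿ
1≄0 = Apart⇒≄0 (1ℚ , 0<1 , 0 , λ _ _ → ℚₚ.≤-refl)

Apart-* : ∀ {x y} → Apart x → Apart y → Apart (x *ᴿ y)
Apart-* {x} {y} (δ , δ>0 , M , h) (ε , ε>0 , N , k) =
  δ ℚ.* ε , δε>0 , M ℕ.⊔ N , λ n a → bound n (h n (⊔ˡ a)) (k n (⊔ʳ {M} a))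
  where
  δε>0 : 0ℚ ℚ.< δ ℚ.* ε
  δε>0 = ≡.subst (ℚ._< δ ℚ.* ε) (ℚₚ.*-zeroʳ δ) (ℚₚ.*-monoʳ-<-pos δ {{ℚ.positive δ>0}} ε>0)
  bound : ∀ n → δ ℚ.≤ ∣ seq x n ∣ → ε ℚ.≤ ∣ seq y n ∣ → δ ℚ.* ε ℚ.≤ ∣ seq x n ℚ.* seq y n ∣
  bound n p q = begin
    δ ℚ.* ε                          ≤⟨ ℚₚ.*-monoʳ-≤-nonNeg ε {{ℚₚ.pos⇒nonNeg ε {{ℚ.positive ε>0}}}} p ⟩
    ∣ seq x n ∣ ℚ.* ε                ≤⟨ ℚₚ.*-monoˡ-≤-nonNeg ∣ seq x n ∣ {{ℚₚ.∣-∣-nonNeg (seq x n)}} q ⟩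
    ∣ seq x n ∣ ℚ.* ∣ seq y n ∣      ≡⟨ ℚₚ.∣p*q∣≡∣p∣*∣q∣ (seq x n) (seq y n) ⟨
    ∣ seq x n ℚ.* seq y n ∣          ∎
    where open ℚₚ.≤-Reasoning

≃-from-0 : ∀ {x y} → x +ᴿ -ᴿ y ≃ 0ᴿ → x ≃ y
≃-from-0 {x} {y} p = R.trans (solve 2 (λ x y → x := (x :- y) :+ y) R.refl x y)
  (R.trans (R.+-congʳ p) (R.+-identityˡ y))

≃0-stable : ∀ {x} → ¬ ¬ x ≃ 0ᴿ → x ≃ 0ᴿ
≃0-stable ¬¬p = ¬Apart⇒≃0 λ a → ¬¬p (Apart⇒≄0 a)

≃-stable : ∀ {x y} → ¬ ¬ x ≃ y → x ≃ y
≃-stable {x} {y} ¬¬p = ≃-from-0 (≃0-stable λ ¬q →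
  ¬¬p λ p → ¬q (R.trans (R.+-congʳ p) (R.-‿inverseʳ y)))

-- If `y` were apart from zero, then `x` could not be, as the product would be apart; so `x` would
-- be zero after all.
*-cancelˡ-≃0 : ∀ {x y} → ¬ x ≃ 0ᴿ → x *ᴿ y ≃ 0ᴿ → y ≃ 0ᴿ
*-cancelˡ-≃0 {x} {y} x≄0 xy≃0 = ¬Apart⇒≃0 λ b → x≄0 (¬Apart⇒≃0 λ a → Apart⇒≄0 (Apart-* {x} {y} a b) xy≃0)

*-cancelˡ : ∀ {d x y} → ¬ d ≃ 0ᴿ → d *ᴿ x ≃ d *ᴿ y → x ≃ y
*-cancelˡ {d} {x} {y} d≄0 p = ≃-from-0 (*-cancelˡ-≃0 d≄0
  (R.trans (solve 3 (λ d x y → d :* (x :- y) := d :* x :- d :* y) R.refl d x y)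
    (R.trans (R.+-congʳ p) (R.-‿inverseʳ (d *ᴿ y)))))

square≃0 : ∀ {x} → x *ᴿ x ≃ 0ᴿ → x ≃ 0ᴿ
square≃0 p = ≃0-stable λ x≄0 → x≄0 (*-cancelˡ-≃0 x≄0 p)

-- Termwise nonnegativity of the chosen sequence; it is not invariant under ≃, but sums of squares have it.
NonNegative : ℝ → Set
NonNegative x = ∀ n → 0ℚ ℚ.≤ seq x n

square-nonNegative : ∀ x → NonNegative (x *ᴿ x)
square-nonNegative x n = ≡.subst (0ℚ ℚ.≤_) (∣p∣²≡p² (ℚₚ.∣p∣≡p∨∣p∣≡-p p))
  (≡.subst (0ℚ ℚ.≤_) (ℚₚ.∣p*q∣≡∣p∣*∣q∣ p p) (ℚₚ.0≤∣p∣ (p ℚ.* p)))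
  where
  p = seq x n
  ∣p∣²≡p² : ∣ p ∣ ≡ p ⊎ ∣ p ∣ ≡ ℚ.- p → ∣ p ∣ ℚ.* ∣ p ∣ ≡ p ℚ.* p
  ∣p∣²≡p² (inj₁ eq) = ≡.cong₂ ℚ._*_ eq eq
  ∣p∣²≡p² (inj₂ eq) = ≡.trans (≡.cong₂ ℚ._*_ eq eq)
    (S.solve 1 (λ p → (S.:- p) S.:* (S.:- p) S.:= p S.:* p) ≡.refl p)
    where module S = +-*-Solver

+-nonNegative : ∀ {x y} → NonNegative x → NonNegative y → NonNegative (x +ᴿ y)
+-nonNegative p q n = ℚₚ.+-mono-≤ (p n) (q n)

*-nonNegative : ∀ {x y} → NonNegative x → NonNegative y → NonNegative (x *ᴿ y)
*-nonNegative {x} {y} p q n = ≡.subst (ℚ._≤ seq x n ℚ.* seq y n) (ℚₚ.*-zeroʳ (seq x n))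
  (ℚₚ.*-monoˡ-≤-nonNeg (seq x n) {{ℚ.nonNegative (p n)}} (q n))

nonNegative-sum≃0 : ∀ {x y} → NonNegative x → NonNegative y → x +ᴿ y ≃ 0ᴿ → x ≃ 0ᴿ
nonNegative-sum≃0 {x} {y} x≥0 y≥0 p = ≃0-intro λ ε ε>0 →
  let (N , k) = converge p ε ε>0 in N , λ n N≤n → begin-strict
    ∣ seq x n ∣                          ≡⟨ ℚₚ.0≤p⇒∣p∣≡p (x≥0 n) ⟩
    seq x n                              ≡⟨ ℚₚ.+-identityʳ (seq x n) ⟨
    seq x n ℚ.+ 0ℚ                       ≤⟨ ℚₚ.+-monoʳ-≤ (seq x n) (y≥0 n) ⟩
    seq x n ℚ.+ seq y n                  ≡⟨ ℚₚ.0≤p⇒∣p∣≡p (ℚₚ.+-mono-≤ (x≥0 n) (y≥0 n)) ⟨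
    ∣ seq x n ℚ.+ seq y n ∣              ≡⟨ ≡.cong ∣_∣ (p-0≡p _) ⟨
    ∣ (seq x n ℚ.+ seq y n) ℚ.- 0ℚ ∣     <⟨ k n N≤n ⟩
    ε                                    ∎
  where open ℚₚ.≤-Reasoning

-- Alternating forms and the determinant

private variable
  c k m n p : ℕ

record IsLinear (ℓ : Vector ℝ n → ℝ) : Set where
  field
    cong   : ∀ {v w} → v ≋ w → ℓ v ≃ ℓ w
    linear : ∀ a v w → ℓ (a *ⱽ v +ⱽ w) ≃ a *ᴿ ℓ v +ᴿ ℓ w

  homo-0 : ℓ 0ⱽ ≃ 0ᴿ
  homo-0 = R.trans
    (R.trans (cong (λ _ → solve 0 (con 0ℚ := :- con 1ℚ :* con 0ℚ :+ con 0ℚ) R.refl)) (linear (-ᴿ 1ᴿ) 0ⱽ 0ⱽ))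
    (solve 1 (λ x → :- con 1ℚ :* x :+ x := con 0ℚ) R.refl (ℓ 0ⱽ))

  homo-* : ∀ a v → ℓ (a *ⱽ v) ≃ a *ᴿ ℓ v
  homo-* a v = R.trans (cong (λ i → R.sym (R.+-identityʳ _)))
    (R.trans (linear a v 0ⱽ) (R.trans (R.+-congˡ homo-0) (R.+-identityʳ _)))

  homo-+ : ∀ v w → ℓ (v +ⱽ w) ≃ ℓ v +ᴿ ℓ w
  homo-+ v w = R.trans (cong (λ i → R.+-congʳ (R.sym (R.*-identityˡ (v i)))))
    (R.trans (linear 1ᴿ v w) (R.+-congʳ (R.*-identityˡ (ℓ v))))

  homo-linComb : ∀ (c : Vector ℝ k) b → ℓ (linComb c b) ≃ ∑[ j < k ] (c j *ᴿ ℓ (b j))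
  homo-linComb {zero}  c b = homo-0
  homo-linComb {suc k} c b = R.trans (linear (c zero) (b zero) (linComb (tail c) (tail b)))
    (R.+-congˡ (homo-linComb (tail c) (tail b)))

linComb-1ᴹ : (v : Vector ℝ n) → v ≋ linComb v 1ᴹ
linComb-1ᴹ v i = R.sym (·1ᴹ-identity v i)

infixl 6 _[_≔_]

_[_≔_] : ∀ {A : Set} → Vector A n → Fin n → A → Vector A n
x [ j ≔ v ] = updateAt x j (const v)

IsLinearMap : (Vector ℝ m → Vector ℝ n) → Set
IsLinearMap L = ∀ i → IsLinear (λ v → L v i)

Form : ℕ → ℕ → Set
Form m n = Vector (Vector ℝ n) m → ℝ

infix 4 _≋ᶠ_
_≋ᶠ_ : (x y : Vector (Vector ℝ n) m) → Set
x ≋ᶠ y = ∀ j → x j ≋ y j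

≗⇒≋ᶠ : {x y : Vector (Vector ℝ n) m} → (∀ j → x j ≡ y j) → x ≋ᶠ y
≗⇒≋ᶠ eq j i = R.reflexive (≡.cong (_$ i) (eq j))

data Consecutive : ∀ {m} → Fin m → Fin m → Set where
  here  : Consecutive {suc (suc m)} zero (suc zero)
  there : ∀ {i j : Fin m} → Consecutive i j → Consecutive (suc i) (suc j)

-- Vanishing is demanded for equal neighbours only, which can be checked for `wedge` by recursion;
-- `repeated` extends it to any two slots.
record IsAlternating (f : Form m n) : Set where
  field
    cong        : ∀ {x y} → x ≋ᶠ y → f x ≃ f y
    linear      : ∀ x j a v w → f (x [ j ≔ a *ⱽ v +ⱽ w ]) ≃ a *ᴿ f (x [ j ≔ v ]) +ᴿ f (x [ j ≔ w ])
    consecutive : ∀ x {i j} → Consecutive i j → x i ≋ x j → f x ≃ 0ᴿ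

∷-updateAt : ∀ {A : Set} (u : A) (x : Vector A n) j v i →
  (u ∷ (x [ j ≔ v ])) i ≡ ((u ∷ x) [ suc j ≔ v ]) i
∷-updateAt u x j v zero    = ≡.refl
∷-updateAt u x j v (suc i) = ≡.refl

∷-updateAt-zero : ∀ {A : Set} (x : Vector A (suc n)) v i → (v ∷ tail x) i ≡ (x [ zero ≔ v ]) i
∷-updateAt-zero x v zero    = ≡.refl
∷-updateAt-zero x v (suc i) = ≡.refl

η-∷ : ∀ {A : Set} (x : Vector A (suc n)) i → x i ≡ (x zero ∷ tail x) i
η-∷ x zero    = ≡.refl
η-∷ x (suc i) = ≡.refl

∷-cong : {v w : Vector ℝ n} {x y : Vector (Vector ℝ n) m} → v ≋ w → x ≋ᶠ y → (v ∷ x) ≋ᶠ (w ∷ y)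
∷-cong p q zero    = p
∷-cong p q (suc j) = q j

≋ᶠ-refl : {x : Vector (Vector ℝ n) m} → x ≋ᶠ x
≋ᶠ-refl j i = R.refl

module Alternating {f : Form m n} (alt : IsAlternating f) where
  open IsAlternating alt public

  cong-≗ : ∀ {x y} → (∀ j → x j ≡ y j) → f x ≃ f y
  cong-≗ eq = cong (≗⇒≋ᶠ eq)

  slot : ∀ x j → IsLinear (λ v → f (x [ j ≔ v ]))
  slot x j = record
    { cong   = λ {v} {w} v≋w → cong (replace-cong x j v≋w)
    ; linear = linear x j
    }
    where
    replace-cong : ∀ {m} (x : Vector (Vector ℝ n) m) j {v w} → v ≋ w → (x [ j ≔ v ]) ≋ᶠ (x [ j ≔ w ])
    replace-cong x zero    v≋w zero    = v≋w
    replace-cong x zero    v≋w (suc i) = ≋-refl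
    replace-cong x (suc j) v≋w zero    = ≋-refl
    replace-cong x (suc j) v≋w (suc i) = replace-cong (tail x) j v≋w i

alternating-∷ : {f : Form (suc m) n} → IsAlternating f → ∀ u → IsAlternating (λ x → f (u ∷ x))
alternating-∷ {f = f} alt u = record
  { cong        = λ p → cong (∷-cong ≋-refl p)
  ; linear      = λ x j a v w → R.trans (cong-≗ (∷-updateAt u x j _))
      (R.trans (linear (u ∷ x) (suc j) a v w)
        (R.sym (R.+-cong (R.*-congˡ (cong-≗ (∷-updateAt u x j v))) (cong-≗ (∷-updateAt u x j w)))))
  ; consecutive = λ x c → consecutive (u ∷ x) (there c)
  }
  where open Alternating alt

head-linear : {f : Form (suc m) n} → IsAlternating f → ∀ x → IsLinear (λ u → f (u ∷ x))
head-linear {f = f} alt x = record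
  { cong   = λ p → cong (∷-cong p ≋ᶠ-refl)
  ; linear = λ a v w → R.trans (cong-≗ (∷-updateAt-zero (0ⱽ ∷ x) _))
      (R.trans (linear (0ⱽ ∷ x) zero a v w)
        (R.sym (R.+-cong (R.*-congˡ (cong-≗ (∷-updateAt-zero (0ⱽ ∷ x) v))) (cong-≗ (∷-updateAt-zero (0ⱽ ∷ x) w)))))
  }
  where open Alternating alt

-- Polarization: expand `B (v +ⱽ w) (v +ⱽ w)`, which vanishes along with both diagonal terms.
bilinear-antisymmetric : (B : Vector ℝ n → Vector ℝ n → ℝ) →
  (∀ w → IsLinear (λ v → B v w)) → (∀ v → IsLinear (B v)) → (∀ v → B v v ≃ 0ᴿ) →
  ∀ v w → B v w ≃ -ᴿ B w v
bilinear-antisymmetric B linˡ linʳ diag v w = begin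
  B v w
    ≈⟨ R.sym (R.trans (R.+-congʳ (R.+-cong (diag v) (diag w))) (solve 1 (λ p → con 0ℚ :+ con 0ℚ :+ p := p) R.refl (B v w))) ⟩
  (B v v +ᴿ B w w) +ᴿ B v w
    ≈⟨ solve 4 (λ p q r s → (p :+ q) :+ r := ((p :+ r) :+ (s :+ q)) :- s) R.refl (B v v) (B w w) (B v w) (B w v) ⟩
  ((B v v +ᴿ B v w) +ᴿ (B w v +ᴿ B w w)) +ᴿ -ᴿ B w v
    ≈⟨ R.+-congʳ (R.+-cong (homo-+ (linʳ v) v w) (homo-+ (linʳ w) v w)) ⟨
  (B v (v +ⱽ w) +ᴿ B w (v +ⱽ w)) +ᴿ -ᴿ B w v           ≈⟨ R.+-congʳ (homo-+ (linˡ (v +ⱽ w)) v w) ⟨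
  B (v +ⱽ w) (v +ⱽ w) +ᴿ -ᴿ B w v                      ≈⟨ R.+-congʳ (diag (v +ⱽ w)) ⟩
  0ᴿ +ᴿ -ᴿ B w v                                       ≈⟨ R.+-identityˡ _ ⟩
  -ᴿ B w v                                             ∎
  where
  open ≈-Reasoning R.setoid
  open IsLinear using (homo-+)

swap-heads : {f : Form (suc (suc m)) n} → IsAlternating f → ∀ v w x → f (v ∷ w ∷ x) ≃ -ᴿ f (w ∷ v ∷ x)
swap-heads {f = f} alt v w x = bilinear-antisymmetric (λ v w → f (v ∷ w ∷ x))
  (λ w → head-linear alt (w ∷ x)) (λ v → head-linear (alternating-∷ alt v) x)
  (λ v → IsAlternating.consecutive alt (v ∷ v ∷ x) here ≋-refl) v w

-- A slot is moved to the front by exchanging neighbours.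
vanishes-at : {f : Form (suc m) n} → IsAlternating f → ∀ v → (∀ y → f (v ∷ y) ≃ 0ᴿ) →
  ∀ x j → x j ≋ v → f x ≃ 0ᴿ
vanishes-at alt v f≃0 x zero p =
  R.trans (IsAlternating.cong alt λ { zero → p ; (suc j) → ≋-refl }) (f≃0 (tail x))
vanishes-at {suc m} {f = f} alt v f≃0 x (suc j) p = R.trans (Alternating.cong-≗ alt (η-∷ x))
  (vanishes-at (alternating-∷ alt (x zero)) v
    (λ y → R.trans (swap-heads alt (x zero) v y)
      (R.trans (R.-‿cong (f≃0 (x zero ∷ y))) (solve 0 (:- con 0ℚ := con 0ℚ) R.refl)))
    (tail x) j p)

first-repeated : {f : Form (suc m) n} → IsAlternating f → ∀ x j → x (suc j) ≋ x zero → f x ≃ 0ᴿ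
first-repeated {suc m} alt x j p = R.trans (Alternating.cong-≗ alt (η-∷ x))
  (vanishes-at (alternating-∷ alt (x zero)) (x zero)
    (λ y → IsAlternating.consecutive alt (x zero ∷ x zero ∷ y) here ≋-refl) (tail x) j p)

repeated : {f : Form m n} → IsAlternating f → ∀ x {i j} → i ≢ j → x i ≋ x j → f x ≃ 0ᴿ
repeated alt x {zero}  {zero}  i≢j p = ⊥-elim (i≢j ≡.refl)
repeated alt x {zero}  {suc j} i≢j p = first-repeated alt x j (≋-sym p)
repeated alt x {suc i} {zero}  i≢j p = first-repeated alt x i p
repeated alt x {suc i} {suc j} i≢j p = R.trans (Alternating.cong-≗ alt (η-∷ x))
  (repeated (alternating-∷ alt (x zero)) (tail x) (λ q → i≢j (≡.cong suc q)) p)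

alternating-+* : {f g : Form m n} → IsAlternating f → IsAlternating g → ∀ c →
  IsAlternating (λ x → c *ᴿ f x +ᴿ g x)
alternating-+* {f = f} {g} f-alt g-alt c = record
  { cong        = λ p → R.+-cong (R.*-congˡ (F.cong p)) (G.cong p)
  ; linear      = λ x j a v w → R.trans
      (R.+-cong (R.*-congˡ (F.linear x j a v w)) (G.linear x j a v w))
      (solve 6 (λ c a p q r s → c :* (a :* p :+ q) :+ (a :* r :+ s) := a :* (c :* p :+ r) :+ (c :* q :+ s))
        R.refl c a _ _ _ _)
  ; consecutive = λ x ij p → R.trans (R.+-cong (R.*-congˡ (F.consecutive x ij p)) (G.consecutive x ij p))
      (solve 1 (λ c → c :* con 0ℚ :+ con 0ℚ := con 0ℚ) R.refl c)
  }
  where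
  module F = IsAlternating f-alt
  module G = IsAlternating g-alt

alternating-∘ : {f : Form m n} {L : Vector ℝ p → Vector ℝ n} → IsAlternating f → IsLinearMap L →
  IsAlternating (λ x → f (λ j → L (x j)))
alternating-∘ {f = f} {L} alt lin = record
  { cong        = λ p → cong λ j i → IsLinear.cong (lin i) (p j)
  ; linear      = λ x j a v w → R.trans (commute x j _)
      (R.trans (IsLinear.cong (slot (L ∘ x) j) λ i → IsLinear.linear (lin i) a v w)
        (R.trans (linear (L ∘ x) j a (L v) (L w))
          (R.sym (R.+-cong (R.*-congˡ (commute x j v)) (commute x j w)))))
  ; consecutive = λ x c p → consecutive (L ∘ x) c λ i → IsLinear.cong (lin i) p
  }
  where
  open Alternating alt
  commute : ∀ x j v → f (λ i → L ((x [ j ≔ v ]) i)) ≃ f ((L ∘ x) [ j ≔ L v ])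
  commute x j v = cong-≗ (map-updateAt {f = L} {g = const v} (λ _ → ≡.refl) x j)

-- Exterior products, the volume form and Cramer's rule

-- The exterior product of a linear form with an m-form: the sum over j of (-1)^j `ℓ (x j)` times
-- `f` at the remaining slots. The minus sign is the cost of moving `ℓ` past one slot.
wedge : (Vector ℝ n → ℝ) → Form m n → Form (suc m) n
wedge {m = zero}  ℓ f x = ℓ (x zero) *ᴿ f (tail x)
wedge {m = suc m} ℓ f x = ℓ (x zero) *ᴿ f (tail x) +ᴿ -ᴿ wedge ℓ (λ y → f (x zero ∷ y)) (tail x)

module _ {ℓ : Vector ℝ n → ℝ} where

  wedge-congᶠ : {f g : Form m n} → (∀ x → f x ≃ g x) → ∀ x → wedge ℓ f x ≃ wedge ℓ g x
  wedge-congᶠ {zero}  p x = R.*-congˡ (p (tail x))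
  wedge-congᶠ {suc m} p x = R.+-cong (R.*-congˡ (p (tail x)))
    (R.-‿cong (wedge-congᶠ (λ y → p (x zero ∷ y)) (tail x)))

  wedge-linearᶠ : (f g : Form m n) → ∀ a x →
    wedge ℓ (λ y → a *ᴿ f y +ᴿ g y) x ≃ a *ᴿ wedge ℓ f x +ᴿ wedge ℓ g x
  wedge-linearᶠ {zero} f g a x =
    solve 4 (λ l a p q → l :* (a :* p :+ q) := a :* (l :* p) :+ l :* q) R.refl (ℓ (x zero)) a (f (tail x)) (g (tail x))
  wedge-linearᶠ {suc m} f g a x = R.trans
    (R.+-congˡ (R.-‿cong (wedge-linearᶠ (λ y → f (x zero ∷ y)) (λ y → g (x zero ∷ y)) a (tail x))))
    (solve 6 (λ l a p q r s → l :* (a :* p :+ q) :- (a :* r :+ s) := a :* (l :* p :- r) :+ (l :* q :- s)) R.refl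
      (ℓ (x zero)) a (f (tail x)) (g (tail x)) _ _)

  wedge-zeroᶠ : {f : Form m n} → (∀ x → f x ≃ 0ᴿ) → ∀ x → wedge ℓ f x ≃ 0ᴿ
  wedge-zeroᶠ {zero}  p x = R.trans (R.*-congˡ (p (tail x))) (R.zeroʳ _)
  wedge-zeroᶠ {suc m} p x = R.trans
    (R.+-cong (R.*-congˡ (p (tail x))) (R.-‿cong (wedge-zeroᶠ (λ y → p (x zero ∷ y)) (tail x))))
    (solve 1 (λ l → l :* con 0ℚ :- con 0ℚ := con 0ℚ) R.refl (ℓ (x zero)))

  wedge-zeroˡ : {f : Form m n} → ∀ x → (∀ j → ℓ (x j) ≃ 0ᴿ) → wedge ℓ f x ≃ 0ᴿ
  wedge-zeroˡ {zero}  x p = R.trans (R.*-congʳ (p zero)) (R.zeroˡ _)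
  wedge-zeroˡ {suc m} {f} x p = R.trans
    (R.+-cong (R.*-congʳ (p zero)) (R.-‿cong (wedge-zeroˡ (tail x) (λ j → p (suc j)))))
    (solve 1 (λ f → con 0ℚ :* f :- con 0ℚ := con 0ℚ) R.refl (f (tail x)))

  module _ (lin : IsLinear ℓ) where
    private module ℓ = IsLinear lin

    wedge-cong : {f : Form m n} → IsAlternating f → ∀ {x y} → x ≋ᶠ y → wedge ℓ f x ≃ wedge ℓ f y
    wedge-cong {zero}  alt p = R.*-cong (ℓ.cong (p zero)) (IsAlternating.cong alt λ j → p (suc j))
    wedge-cong {suc m} alt {x} {y} p = R.+-cong
      (R.*-cong (ℓ.cong (p zero)) (IsAlternating.cong alt λ j → p (suc j)))
      (R.-‿cong (R.trans
        (wedge-congᶠ (λ z → IsAlternating.cong alt (∷-cong (p zero) ≋ᶠ-refl)) (tail x))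
        (wedge-cong (alternating-∷ alt (y zero)) λ j → p (suc j))))

    wedge-linear : {f : Form m n} → IsAlternating f → ∀ x j a v w →
      wedge ℓ f (x [ j ≔ a *ⱽ v +ⱽ w ]) ≃ a *ᴿ wedge ℓ f (x [ j ≔ v ]) +ᴿ wedge ℓ f (x [ j ≔ w ])
    wedge-linear {zero} {f} alt x zero a v w = R.trans (R.*-congʳ (ℓ.linear a v w))
      (solve 4 (λ a l k p → (a :* l :+ k) :* p := a :* (l :* p) :+ k :* p) R.refl a (ℓ v) (ℓ w) (f (tail x)))
    wedge-linear {suc m} {f} alt x zero a v w = R.trans
      (R.+-cong (R.*-congʳ (ℓ.linear a v w)) (R.-‿cong (R.trans
        (wedge-congᶠ (λ y → IsLinear.linear (head-linear alt y) a v w) (tail x))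
        (wedge-linearᶠ (λ y → f (v ∷ y)) (λ y → f (w ∷ y)) a (tail x)))))
      (solve 6 (λ a l k p q r → (a :* l :+ k) :* p :- (a :* q :+ r) := a :* (l :* p :- q) :+ (k :* p :- r)) R.refl
        a (ℓ v) (ℓ w) (f (tail x)) _ _)
    wedge-linear {suc m} {f} alt x (suc j) a v w = R.trans
      (R.+-cong (R.*-congˡ (IsAlternating.linear alt (tail x) j a v w))
        (R.-‿cong (wedge-linear (alternating-∷ alt (x zero)) (tail x) j a v w)))
      (solve 6 (λ l a p q r s → l :* (a :* p :+ q) :- (a :* r :+ s) := a :* (l :* p :- r) :+ (l :* q :- s)) R.refl
        (ℓ (x zero)) a _ _ _ _)

    wedge-consecutive : {f : Form m n} → IsAlternating f → ∀ x {i j} → Consecutive i j → x i ≋ x j →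
      wedge ℓ f x ≃ 0ᴿ
    wedge-consecutive {suc zero} {f} alt x here p = R.trans
      (R.+-cong (R.*-cong (ℓ.cong p) (IsAlternating.cong alt λ { zero → ≋-sym p }))
        (R.-‿cong (R.*-congˡ (IsAlternating.cong alt λ { zero → ≋-refl }))))
      (R.-‿inverseʳ (ℓ (x (suc zero)) *ᴿ f (x zero ∷ tail (tail x))))
    -- The terms in which `ℓ` takes one of the two equal slots cancel; in all others both slots
    -- remain as the heads of `f`.
    wedge-consecutive {suc (suc m)} {f} alt x here p = R.trans
      (R.+-cong (R.*-cong (ℓ.cong p) (IsAlternating.cong alt {y = x zero ∷ tail (tail x)} λ { zero → ≋-sym p ; (suc j) → ≋-refl }))
        (R.-‿cong (R.+-congˡ (R.-‿cong (wedge-zeroᶠ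
          (λ y → IsAlternating.consecutive alt (x zero ∷ x (suc zero) ∷ y) here p) (tail (tail x)))))))
      (solve 1 (λ q → q :- (q :- con 0ℚ) := con 0ℚ) R.refl (ℓ (x (suc zero)) *ᴿ f (x zero ∷ tail (tail x))))
    wedge-consecutive {suc m} {f} alt x (there c) p = R.trans
      (R.+-cong (R.*-congˡ (IsAlternating.consecutive alt (tail x) c p))
        (R.-‿cong (wedge-consecutive (alternating-∷ alt (x zero)) (tail x) c p)))
      (solve 1 (λ l → l :* con 0ℚ :- con 0ℚ := con 0ℚ) R.refl (ℓ (x zero)))

    wedge-alternating : {f : Form m n} → IsAlternating f → IsAlternating (wedge ℓ f)
    wedge-alternating alt = record
      { cong        = wedge-cong alt
      ; linear      = wedge-linear alt
      ; consecutive = wedge-consecutive alt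
      }

    -- Moving `v` from the front of `f` into the slot taken out by `ℓ` costs exactly the sign which
    -- that term carries in the wedge.
    wedge-expansion : {f : Form (suc m) n} → IsAlternating f → ∀ v x →
      wedge ℓ (λ y → f (v ∷ y)) x ≃ ∑[ j < suc m ] (f (x [ j ≔ v ]) *ᴿ ℓ (x j))
    wedge-expansion {zero} {f} alt v x = R.trans (R.*-comm _ _)
      (R.trans (R.*-congʳ (Alternating.cong-≗ alt (∷-updateAt-zero x v))) (R.sym (R.+-identityʳ _)))
    wedge-expansion {suc m} {f} alt v x = R.+-cong
      (R.trans (R.*-comm _ _) (R.*-congʳ (Alternating.cong-≗ alt (∷-updateAt-zero x v))))
      (begin
        -ᴿ wedge ℓ (λ y → f (v ∷ x zero ∷ y)) (tail x)
          ≈⟨ solve 1 (λ p → :- p := :- con 1ℚ :* p :+ con 0ℚ) R.refl _ ⟩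
        -- The sign is moved under `wedge` by linearity in the form, with the zero form as second
        -- summand.
        (-ᴿ 1ᴿ) *ᴿ wedge ℓ (λ y → f (v ∷ x zero ∷ y)) (tail x) +ᴿ 0ᴿ
          ≈⟨ R.+-congˡ (wedge-zeroᶠ (λ _ → R.refl) (tail x)) ⟨
        (-ᴿ 1ᴿ) *ᴿ wedge ℓ (λ y → f (v ∷ x zero ∷ y)) (tail x) +ᴿ wedge ℓ (λ _ → 0ᴿ) (tail x)
          ≈⟨ wedge-linearᶠ (λ y → f (v ∷ x zero ∷ y)) (λ _ → 0ᴿ) (-ᴿ 1ᴿ) (tail x) ⟨
        wedge ℓ (λ y → (-ᴿ 1ᴿ) *ᴿ f (v ∷ x zero ∷ y) +ᴿ 0ᴿ) (tail x)
          ≈⟨ wedge-congᶠ (λ y → R.trans (solve 1 (λ p → :- con 1ℚ :* p :+ con 0ℚ := :- p) R.refl _)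
               (R.sym (swap-heads alt (x zero) v y))) (tail x) ⟩
        wedge ℓ (λ y → f (x zero ∷ v ∷ y)) (tail x)
          ≈⟨ wedge-expansion (alternating-∷ alt (x zero)) v (tail x) ⟩
        ∑[ j < suc m ] (f (x zero ∷ (tail x [ j ≔ v ])) *ᴿ ℓ (x (suc j)))
          ≈⟨ sum-cong-≋ {suc m} (λ j → R.*-congʳ {ℓ (x (suc j))} (Alternating.cong-≗ alt
               {x zero ∷ (tail x [ j ≔ v ])} {x [ suc j ≔ v ]} λ { zero → ≡.refl ; (suc i) → ≡.refl })) ⟩
        ∑[ j < suc m ] (f (x [ suc j ≔ v ]) *ᴿ ℓ (x (suc j))) ∎)
      where open ≈-Reasoning R.setoid

coordinate-linear : (i : Fin n) → IsLinear (_$ i)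
coordinate-linear i = record { cong = _$ i ; linear = λ a v w → R.refl }

-- Laplace expansion along the first coordinate: the exterior product of the coordinate forms.
volume : Form n n
volume {zero}  _ = 1ᴿ
volume {suc n} = wedge (_$ zero) (λ x → volume (λ j → tail (x j)))

volume-alternating : IsAlternating (volume {n})
volume-alternating {zero} = record
  { cong        = λ _ → R.refl
  ; linear      = λ _ ()
  ; consecutive = λ _ ()
  }
volume-alternating {suc n} = wedge-alternating (coordinate-linear zero)
  (alternating-∘ volume-alternating λ i → coordinate-linear (suc i))

volume-1ᴹ : volume (1ᴹ {n}) ≃ 1ᴿ
volume-1ᴹ {zero}        = R.refl
volume-1ᴹ {suc zero}    = R.*-identityˡ 1ᴿ
volume-1ᴹ {suc (suc n)} = R.trans
  (R.+-cong (R.trans (R.*-identityˡ _) (volume-1ᴹ {suc n}))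
    (R.-‿cong (wedge-zeroˡ {ℓ = _$ zero} {m = n} {f = λ y → volume (λ j → tail ((1ᴹ zero ∷ y) j))} (tail 1ᴹ) λ _ → R.refl)))
  (solve 0 (con 1ℚ :- con 0ℚ := con 1ℚ) R.refl)

extend : Vector ℝ n → Vector ℝ (suc n)
extend = 0ᴿ ∷_

extend-linear : IsLinearMap (extend {n})
extend-linear zero    = record
  { cong = λ _ → R.refl ; linear = λ a _ _ → solve 1 (λ a → con 0ℚ := a :* con 0ℚ :+ con 0ℚ) R.refl a }
extend-linear (suc i) = coordinate-linear i

extend-tail : (v : Vector ℝ (suc n)) → v ≋ v zero *ⱽ 1ᴹ zero +ⱽ extend (tail v)
extend-tail v zero    = solve 1 (λ a → a := a :* con 1ℚ :+ con 0ℚ) R.refl (v zero)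
extend-tail v (suc i) = solve 2 (λ a b → b := a :* con 0ℚ :+ b) R.refl (v zero) (v (suc i))

-- Each slot differs from its projection by a multiple of the first unit vector, and a form with
-- that vector in a slot vanishes by assumption.
project-slots : {f : Form m (suc n)} → IsAlternating f →
  (∀ x j → x j ≋ 1ᴹ zero → f x ≃ 0ᴿ) → ∀ x → f x ≃ f (λ j → extend (tail (x j)))
project-slots {zero}  alt f≃0 x = IsAlternating.cong alt λ ()
project-slots {suc m} {f = f} alt f≃0 x = begin
  f x                                                      ≈⟨ Alternating.cong-≗ alt (η-∷ x) ⟩
  f (x zero ∷ tail x)                                      ≈⟨ H.cong (extend-tail (x zero)) ⟩
  f (a *ⱽ 1ᴹ zero +ⱽ y zero ∷ tail x)                      ≈⟨ H.linear a (1ᴹ zero) (y zero) ⟩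
  a *ᴿ f (1ᴹ zero ∷ tail x) +ᴿ f (y zero ∷ tail x)         ≈⟨ R.+-congʳ (R.*-congˡ (f≃0 _ zero ≋-refl)) ⟩
  a *ᴿ 0ᴿ +ᴿ f (y zero ∷ tail x)
    ≈⟨ solve 2 (λ a p → a :* con 0ℚ :+ p := p) R.refl a _ ⟩
  f (y zero ∷ tail x)
    ≈⟨ project-slots (alternating-∷ alt (y zero)) (λ z j p → f≃0 _ (suc j) p) (tail x) ⟩
  f (y zero ∷ tail y)                                      ≈⟨ Alternating.cong-≗ alt (η-∷ y) ⟨
  f y                                                      ∎
  where
  open ≈-Reasoning R.setoid
  a = x zero zero
  y = λ j → extend (tail (x j))
  module H = IsLinear (head-linear alt (tail x))

mutual
  -- With the first unit vector in front, the other slots may be projected to one dimension less,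
  -- where induction applies. So `f` vanishes as soon as that vector occupies a slot; then all slots
  -- may be projected, and there are too many of them.
  unique-vanishing : {f : Form n n} → IsAlternating f → f 1ᴹ ≃ 0ᴿ → ∀ x → f x ≃ 0ᴿ
  unique-vanishing {zero}  alt f1≃0 x = R.trans (IsAlternating.cong alt λ ()) f1≃0
  unique-vanishing {suc n} {f} alt f1≃0 x = R.trans (project-slots alt e₀-vanishes x)
    (overfull-vanishing (alternating-∘ alt extend-linear) (λ j → tail (x j)))
    where
    alt₀ = alternating-∷ alt (1ᴹ zero)
    extend-1ᴹ : ∀ j → 1ᴹ j ≋ (1ᴹ zero ∷ (λ j → extend (1ᴹ j))) j
    extend-1ᴹ zero    i       = R.refl
    extend-1ᴹ (suc j) zero    = R.refl
    extend-1ᴹ (suc j) (suc i) = R.refl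
    e₀-first : ∀ y → f (1ᴹ zero ∷ y) ≃ 0ᴿ
    e₀-first y = R.trans
      (project-slots alt₀ (λ z j p → repeated alt (1ᴹ zero ∷ z) {suc j} {zero} (λ ()) p) y)
      (unique-vanishing (alternating-∘ alt₀ extend-linear)
        (R.trans (R.sym (IsAlternating.cong alt extend-1ᴹ)) f1≃0) (λ j → tail (y j)))
    e₀-vanishes : ∀ y j → y j ≋ 1ᴹ zero → f y ≃ 0ᴿ
    e₀-vanishes = vanishes-at alt (1ᴹ zero) e₀-first

  -- Fixing the first slot leaves an n-form, to be tested on the unit vectors only. There the first
  -- slot is a combination of vectors already present.
  overfull-vanishing : {f : Form (suc n) n} → IsAlternating f → ∀ x → f x ≃ 0ᴿ
  overfull-vanishing {n} {f} alt x = R.trans (Alternating.cong-≗ alt (η-∷ x))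
    (unique-vanishing (alternating-∷ alt (x zero)) (begin
      f (x zero ∷ 1ᴹ)                                ≈⟨ H.cong (linComb-1ᴹ (x zero)) ⟩
      f (linComb (x zero) 1ᴹ ∷ 1ᴹ)                   ≈⟨ H.homo-linComb (x zero) 1ᴹ ⟩
      ∑[ i < n ] (x zero i *ᴿ f (1ᴹ i ∷ 1ᴹ))
        ≈⟨ sum-zero (λ i → R.trans (R.*-congˡ (first-repeated alt (1ᴹ i ∷ 1ᴹ) i ≋-refl)) (R.zeroʳ _)) ⟩
      0ᴿ                                             ∎) (tail x))
    where
    open ≈-Reasoning R.setoid
    module H = IsLinear (head-linear alt 1ᴹ)

-- For each coordinate form, its wedge with `volume` has one slot more than the dimension, so it
-- vanishes on `v ∷ x`. Expanding this zero gives the identity, free of divisions.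
cramer : ∀ (x : Vector (Vector ℝ n) n) v → volume x *ⱽ v ≋ linComb (λ j → volume (x [ j ≔ v ])) x
cramer {suc n} x v i = R.trans
  (solve 3 (λ d l s → d :* l := (l :* d :- s) :+ s) R.refl (volume x) (v i)
    (wedge (_$ i) (λ y → volume (v ∷ y)) x))
  (R.trans
    (R.+-cong (overfull-vanishing (wedge-alternating (coordinate-linear i) volume-alternating) (v ∷ x))
      (wedge-expansion (coordinate-linear i) volume-alternating v x))
    (R.+-identityˡ _))

-- Multiplicativity of the determinant

·-linear : (A : Matrix n) → IsLinearMap (A ·_)
·-linear A i = record
  { cong   = λ p → ·-cong A p i
  ; linear = λ a v w → R.trans (·-+ A (a *ⱽ v) w i) (R.+-congʳ (·-* A a v i))
  }

det : Matrix n → ℝ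
det A = volume (λ j → A · 1ᴹ j)

-- The difference of the two sides is an alternating form in `x` that vanishes on the unit vectors.
volume-· : ∀ (A : Matrix n) x → volume (λ j → A · x j) ≃ det A *ᴿ volume x
volume-· {n} A x = ≃-from-0 (R.trans
  (solve 3 (λ p d q → p :- d :* q := (:- d) :* q :+ p) R.refl (volume (λ j → A · x j)) (det A) (volume x))
  (unique-vanishing
    (alternating-+* volume-alternating (alternating-∘ volume-alternating (·-linear A)) (-ᴿ det A))
    (R.trans (R.+-congʳ (R.*-congˡ (volume-1ᴹ {n})))
      (solve 1 (λ d → (:- d) :* con 1ℚ :+ d := con 0ℚ) R.refl (det A))) x))

*ᴹ-· : ∀ (A B : Matrix n) v → (A *ᴹ B) · v ≋ A · B · v
*ᴹ-· A B v i = sum-assoc (A i) B v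

det-1ᴹ : det (1ᴹ {n}) ≃ 1ᴿ
det-1ᴹ {n} = R.trans (IsAlternating.cong (volume-alternating {n}) λ j → 1ᴹ·-identity (1ᴹ j)) (volume-1ᴹ {n})

det-* : (A B : Matrix n) → det (A *ᴹ B) ≃ det A *ᴿ det B
det-* A B = R.trans (IsAlternating.cong volume-alternating λ j → *ᴹ-· A B (1ᴹ j))
  (volume-· A (λ j → B · 1ᴹ j))

det-cong : {A B : Matrix n} → A ≃ᴹ B → det A ≃ det B
det-cong {n} {A} {B} p = IsAlternating.cong (volume-alternating {n}) λ j i →
  sum-cong-≋ {n} λ k → R.*-congʳ {1ᴹ j k} (p i k)

-- Completing independent vectors to a basis

linComb-+ : ∀ a a′ (x : Vector (Vector ℝ n) k) → linComb (a +ⱽ a′) x ≋ linComb a x +ⱽ linComb a′ x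
linComb-+ a a′ x i = R.trans (sum-cong-≋ λ j → R.distribʳ (x j i) (a j) (a′ j))
  (∑-distrib-+ (λ j → a j *ᴿ x j i) (λ j → a′ j *ᴿ x j i))

linComb-* : ∀ t a (x : Vector (Vector ℝ n) k) → linComb (t *ⱽ a) x ≋ t *ⱽ linComb a x
linComb-* t a x i = R.trans (sum-cong-≋ λ j → R.*-assoc t (a j) (x j i))
  (R.sym (*-distribˡ-sum t (λ j → a j *ᴿ x j i)))

linComb-0 : (x : Vector (Vector ℝ n) k) → linComb 0ⱽ x ≋ 0ⱽ
linComb-0 x i = sum-zero λ j → R.zeroˡ (x j i)

-- Membership is asked of the products because in `exchangeable` a free basis vector enters only
-- through its zero coefficient.
linComb-∈ : (W : Subspace n) (a : Vector ℝ k) (x : Vector (Vector ℝ n) k) →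
  (∀ j → a j *ⱽ x j ∈ ⟦ W ⟧ⱽ) → linComb a x ∈ ⟦ W ⟧ⱽ
linComb-∈ {k = zero}  W a x p = Subspace.0-closed W
linComb-∈ {k = suc k} W a x p = Subspace.+-closed W (p zero) (linComb-∈ W (tail a) (tail x) (λ j → p (suc j)))

0ˢ : Subspace n
0ˢ = record
  { ⟦_⟧ⱽ     = _≋ 0ⱽ
  ; resp     = λ v≋w p → ≋-trans (≋-sym v≋w) p
  ; 0-closed = ≋-refl
  ; +-closed = λ p q i → R.trans (R.+-cong (p i) (q i)) (R.+-identityˡ 0ᴿ)
  ; *-closed = λ a p i → R.trans (R.*-congˡ (p i)) (R.zeroʳ a)
  }

infixl 6 _+span_

_+span_ : Subspace n → Vector (Vector ℝ n) k → Subspace n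
W +span x = record
  { ⟦_⟧ⱽ     = λ v → ∃ λ a → ∃ λ w → w ∈ ⟦ W ⟧ⱽ × v ≋ linComb a x +ⱽ w
  ; resp     = λ { v≋v′ (a , w , w∈ , p) → a , w , w∈ , ≋-trans (≋-sym v≋v′) p }
  ; 0-closed = 0ⱽ , 0ⱽ , W.0-closed , λ i → R.sym (R.trans (R.+-congʳ (linComb-0 x i)) (R.+-identityˡ 0ᴿ))
  ; +-closed = λ { (a , w , w∈ , p) (a′ , w′ , w′∈ , p′) →
      a +ⱽ a′ , w +ⱽ w′ , W.+-closed w∈ w′∈ , λ i → R.trans (R.+-cong (p i) (p′ i))
        (R.trans (solve 4 (λ p q r s → (p :+ q) :+ (r :+ s) := (p :+ r) :+ (q :+ s)) R.refl _ _ _ _)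
          (R.+-congʳ (R.sym (linComb-+ a a′ x i)))) }
  ; *-closed = λ { t (a , w , w∈ , p) →
      t *ⱽ a , t *ⱽ w , W.*-closed t w∈ , λ i → R.trans (R.*-congˡ (p i))
        (R.trans (R.distribˡ t _ _) (R.+-congʳ (R.sym (linComb-* t a x i)))) }
  }
  where module W = Subspace W

span-generator : (W : Subspace n) (x : Vector (Vector ℝ n) k) → ∀ j → x j ∈ ⟦ W +span x ⟧ⱽ
span-generator W x j = 1ᴹ j , 0ⱽ , Subspace.0-closed W , λ i →
  R.sym (R.trans (R.+-identityʳ _) (1ᴹ·-identity (λ l → x l i) j))

span-⊇ : (W : Subspace n) (x : Vector (Vector ℝ n) k) → ∀ {w} → w ∈ ⟦ W ⟧ⱽ → w ∈ ⟦ W +span x ⟧ⱽ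
span-⊇ W x {w} w∈ = 0ⱽ , w , w∈ , λ i → R.sym (R.trans (R.+-congʳ (linComb-0 x i)) (R.+-identityˡ (w i)))

LinearlyIndependent : Vector (Vector ℝ n) k → Set
LinearlyIndependent b = ∀ a → linComb a b ≋ 0ⱽ → a ≋ 0ⱽ

-- free and bound enumerate the slots of the basis without repetition, which avoids counting arguments.
record Frame (c : ℕ) (b : Vector (Vector ℝ n) k) : Set where
  field
    basis          : Vector (Vector ℝ n) n
    nondegenerate  : ¬ volume basis ≃ 0ᴿ
    free           : Fin c → Fin n
    bound          : Fin k → Fin n
    free-injective : ∀ {i j} → free i ≡ free j → i ≡ j
    free≢bound     : ∀ i j → free i ≢ bound j
    cover          : ∀ j → (∃ λ i → free i ≡ j) ⊎ (∃ λ i → bound i ≡ j)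
    basis-bound    : ∀ i → basis (bound i) ≋ b i

  replace-free : ∀ x → (∀ i → x (bound i) ≋ b i) → ∀ l v i → (x [ free l ≔ v ]) (bound i) ≋ b i
  replace-free x x-bound l v i = ≋-trans
    (λ r → R.reflexive (≡.cong (_$ r) (updateAt-minimal (bound i) (free l) x λ p → free≢bound l i (≡.sym p))))
    (x-bound i)

  -- The factor `volume basis` is the denominator that Cramer's rule leaves uncleared; the bound
  -- part of the sum is absorbed into `W`.
  decompose : (W : Subspace n) → (∀ i → b i ∈ ⟦ W ⟧ⱽ) →
    ∀ v → volume basis *ⱽ v ∈ ⟦ W +span (basis ∘ free) ⟧ⱽ
  decompose W b∈W v = Subspace.resp S (≋-sym (cramer basis v))
    (linComb-∈ S _ basis λ j → Subspace.*-closed S _ (member j (cover j)))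
    where
    S = W +span (basis ∘ free)
    member : ∀ j → (∃ λ i → free i ≡ j) ⊎ (∃ λ i → bound i ≡ j) → basis j ∈ ⟦ S ⟧ⱽ
    member _ (inj₁ (i , ≡.refl)) = span-generator W (basis ∘ free) i
    member _ (inj₂ (i , ≡.refl)) = span-⊇ W _ (Subspace.resp W (≋-sym (basis-bound i)) (b∈W i))

exchange : {b : Vector (Vector ℝ n) (suc k)} (F : Frame (suc c) (tail b)) →
  ∀ l → ¬ volume (Frame.basis F [ Frame.free F l ≔ b zero ]) ≃ 0ᴿ → Frame c b
exchange {b = b} F l nonzero = record
  { basis          = basis [ free l ≔ b zero ]
  ; nondegenerate  = nonzero
  ; free           = free ∘ punchIn l
  ; bound          = free l ∷ bound
  ; free-injective = λ p → punchIn-injective l _ _ (free-injective p)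
  ; free≢bound     = λ { i zero p → punchInᵢ≢i l i (free-injective p) ; i (suc j) → free≢bound _ j }
  ; cover          = λ j → cover′ j (cover j)
  ; basis-bound    = λ { zero i → R.reflexive (≡.cong (_$ i) (updateAt-updates (free l) basis))
                       ; (suc j) → ≋-trans
                           (λ i → R.reflexive (≡.cong (_$ i)
                             (updateAt-minimal (bound j) (free l) basis λ p → free≢bound l j (≡.sym p))))
                           (basis-bound j) }
  }
  where
  open Frame F
  cover′ : ∀ j → (∃ λ i → free i ≡ j) ⊎ (∃ λ i → bound i ≡ j) →
    (∃ λ i → free (punchIn l i) ≡ j) ⊎ (∃ λ i → (free l ∷ bound) i ≡ j)
  cover′ j (inj₂ (i , p)) = inj₂ (suc i , p)
  cover′ j (inj₁ (i , p)) with l ≟ i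
  ... | yes ≡.refl = inj₂ (zero , p)
  ... | no l≢i     = inj₁ (punchOut l≢i , ≡.trans (≡.cong free (punchIn-punchOut l≢i)) p)

-- By Cramer's rule, if no free slot could receive b₀ then volume basis · b₀ would lie in the span of the others.
exchangeable : {b : Vector (Vector ℝ n) (suc k)} → LinearlyIndependent b → (F : Frame c (tail b)) →
  ¬ (∀ l → volume (Frame.basis F [ Frame.free F l ≔ b zero ]) ≃ 0ᴿ)
exchangeable {b = b} independent F all-zero = nondegenerate (dependent dependence)
  where
  open Frame F
  S = 0ˢ +span tail b
  dependence : volume basis *ⱽ b zero ∈ ⟦ S ⟧ⱽ
  dependence = Subspace.resp S (≋-sym (cramer basis (b zero)))
    (linComb-∈ S (λ j → volume (basis [ j ≔ b zero ])) basis λ j → term j (cover j))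
    where
    term : ∀ j → (∃ λ i → free i ≡ j) ⊎ (∃ λ i → bound i ≡ j) →
      volume (basis [ j ≔ b zero ]) *ⱽ basis j ∈ ⟦ S ⟧ⱽ
    term _ (inj₁ (i , ≡.refl)) = Subspace.resp S
      (λ l → R.sym (R.trans (R.*-congʳ (all-zero i)) (R.zeroˡ _))) (Subspace.0-closed S)
    term _ (inj₂ (i , ≡.refl)) = Subspace.*-closed S _
      (Subspace.resp S (≋-sym (basis-bound i)) (span-generator 0ˢ (tail b) i))
  dependent : volume basis *ⱽ b zero ∈ ⟦ S ⟧ⱽ → volume basis ≃ 0ᴿ
  dependent (a , w , w≋0 , p) = independent (volume basis ∷ (-ᴿ 1ᴿ) *ⱽ a) (λ i → begin
    volume basis *ᴿ b zero i +ᴿ linComb ((-ᴿ 1ᴿ) *ⱽ a) (tail b) i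
      ≈⟨ R.+-cong (p i) (linComb-* (-ᴿ 1ᴿ) a (tail b) i) ⟩
    (linComb a (tail b) i +ᴿ w i) +ᴿ (-ᴿ 1ᴿ) *ᴿ linComb a (tail b) i
      ≈⟨ solve 2 (λ s w → (s :+ w) :+ (:- con 1ℚ) :* s := w) R.refl _ _ ⟩
    w i                                                                ≈⟨ w≋0 i ⟩
    0ᴿ                                                                 ∎) zero
    where open ≈-Reasoning R.setoid

-- Which slot can take the new vector is not decidable. If no frame existed, each candidate volume
-- would be stably zero, and `exchangeable` refutes that. The tail of `b` is placed first, with one
-- more free slot.
frame : c ℕ.+ k ≡ n → (b : Vector (Vector ℝ n) k) → LinearlyIndependent b → ¬ ¬ Frame c b
frame {c} {zero} eq b _ ¬F with ≡.trans (≡.sym (ℕₚ.+-identityʳ c)) eq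
... | ≡.refl = ¬F record
  { basis          = 1ᴹ
  ; nondegenerate  = λ p → 1≄0 (R.trans (R.sym (volume-1ᴹ {c})) p)
  ; free           = id
  ; bound          = λ ()
  ; free-injective = id
  ; free≢bound     = λ _ ()
  ; cover          = λ j → inj₁ (j , ≡.refl)
  ; basis-bound    = λ ()
  }
frame {c} {suc k} eq b independent ¬F =
  frame {suc c} (≡.trans (≡.sym (ℕₚ.+-suc c k)) eq) (tail b) tail-independent λ F →
    exchangeable {b = b} independent F λ l → ≃0-stable λ nonzero → ¬F (exchange {b = b} F l nonzero)
  where
  tail-independent : LinearlyIndependent (tail b)
  tail-independent a p j = independent (0ᴿ ∷ a)
    (λ i → R.trans (R.+-congʳ (R.zeroˡ (b zero i))) (R.trans (R.+-identityˡ _) (p i))) (suc j)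

-- Matrices of finite order

-- `A` acts on the argument, so that `iter A k (A · v)` is by definition the next iterate. In
-- `invariantForm` this makes the shifted sum overlap the original one, leaving only the first and
-- last terms to compare.
iter : Matrix n → ℕ → Vector ℝ n → Vector ℝ n
iter A zero    v = v
iter A (suc k) v = iter A k (A · v)

iter-+ : ∀ (A : Matrix n) k l v → iter A (k ℕ.+ l) v ≡ iter A l (iter A k v)
iter-+ A zero    l v = ≡.refl
iter-+ A (suc k) l v = iter-+ A k l (A · v)

iter-linear : (A : Matrix n) → ∀ k → IsLinearMap (iter A k)
iter-linear A zero    i = coordinate-linear i
iter-linear A (suc k) i = record
  { cong   = λ p → IsLinear.cong (iter-linear A k i) (·-cong A p)
  ; linear = λ a v w → R.trans
      (IsLinear.cong (iter-linear A k i) λ j → IsLinear.linear (·-linear A j) a v w)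
      (IsLinear.linear (iter-linear A k i) a (A · v) (A · w))
  }

-- The successor makes the exponent positive; it need not be the least one.
HasFiniteOrder : Matrix n → Set
HasFiniteOrder A = ∃ λ m → ∀ v → iter A (suc m) v ≋ v

·-injective : (g : GL n) → ∀ {v w} → mat g · v ≋ mat g · w → v ≋ w
·-injective g {v} {w} p = ≋-trans (≋-sym (undo v)) (≋-trans (·-cong (inv g) p) (undo w))
  where
  undo : ∀ v → inv g · mat g · v ≋ v
  undo v = ≋-trans (≋-sym (*ᴹ-· (inv g) (mat g) v))
    (≋-trans (λ i → sum-cong-≋ λ j → R.*-congʳ {v j} (inverseˡ g i j)) (1ᴹ·-identity v))

iter-injective : (g : GL n) → ∀ k {v w} → iter (mat g) k v ≋ iter (mat g) k w → v ≋ w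
iter-injective g zero    p = p
iter-injective g (suc k) p = ·-injective g (iter-injective g k p)

module _ (G : Subgroup (GL-group n)) {g : GL n} (g∈G : g ∈ ⟦ G ⟧ᴳ) where
  open Group (GL-group n) using (_∙_; ε)

  power : ℕ → Σ (GL n) ⟦ G ⟧ᴳ
  power zero    = ε , Subgroup.ε-closed G
  power (suc k) = proj₁ (power k) ∙ g , Subgroup.∙-closed G (proj₂ (power k)) g∈G

  power-· : ∀ k v → mat (proj₁ (power k)) · v ≋ iter (mat g) k v
  power-· zero    v = 1ᴹ·-identity v
  power-· (suc k) v = ≋-trans (*ᴹ-· (mat (proj₁ (power k))) (mat g) v) (power-· k (mat g · v))

  -- One power more than the enumeration has entries forces two exponents to share a position; the
  -- smaller power is then cancelled by injectivity.
  finite⇒finiteOrder : IsFinite G → HasFiniteOrder (mat g)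
  finite⇒finiteOrder (xs , enumerates) = o , period
    where
    position : Fin (suc (List.length xs)) → Fin (List.length xs)
    position i = Any.index (enumerates (power (toℕ i)))
    collision = pigeonhole (ℕₚ.n<1+n (List.length xs)) position
    i = proj₁ collision
    j = proj₁ (proj₂ collision)
    -- Since `i < j` unfolds to `suc i ≤ j`, the exponents differ by `suc o`, which is positive.
    i<j = ℕₚ.m≤n⇒∃[o]m+o≡n (proj₁ (proj₂ (proj₂ collision)))
    o = proj₁ i<j
    same-power : mat (proj₁ (power (toℕ i))) ≃ᴹ mat (proj₁ (power (toℕ j)))
    same-power r c = R.trans (at i r c)
      (R.trans (R.reflexive (≡.cong (λ l → mat (proj₁ (List.lookup xs l)) r c) (proj₂ (proj₂ (proj₂ collision)))))
        (R.sym (at j r c)))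
      where
      at : ∀ i → mat (proj₁ (power (toℕ i))) ≃ᴹ mat (proj₁ (List.lookup xs (position i)))
      at i = lookup-index (enumerates (power (toℕ i)))
    period : ∀ v → iter (mat g) (suc o) v ≋ v
    period v = iter-injective g (toℕ i) λ r → begin
      iter (mat g) (toℕ i) (iter (mat g) (suc o) v) r    ≡⟨ ≡.cong (_$ r) (iter-+ (mat g) (suc o) (toℕ i) v) ⟨
      iter (mat g) (suc o ℕ.+ toℕ i) v r
        ≡⟨ ≡.cong (λ l → iter (mat g) l v r) (≡.trans (≡.cong suc (ℕₚ.+-comm o (toℕ i))) (proj₂ i<j)) ⟩
      iter (mat g) (toℕ j) v r                           ≈⟨ power-· (toℕ j) v r ⟨
      (mat (proj₁ (power (toℕ j))) · v) r
        ≈⟨ sum-cong-≋ (λ c → R.*-congʳ {v c} (same-power r c)) ⟨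
      (mat (proj₁ (power (toℕ i))) · v) r                ≈⟨ power-· (toℕ i) v r ⟩
      iter (mat g) (toℕ i) v r                           ∎
      where open ≈-Reasoning R.setoid

-- Invariant inner products

record InvariantForm (A : Matrix n) : Set where
  field
    ⟨_,_⟩     : Vector ℝ n → Vector ℝ n → ℝ
    linear    : ∀ v → IsLinear ⟨ v ,_⟩
    symmetric : ∀ v w → ⟨ v , w ⟩ ≃ ⟨ w , v ⟩
    invariant : ∀ v w → ⟨ A · v , A · w ⟩ ≃ ⟨ v , w ⟩
    definite  : ∀ v → ⟨ v , v ⟩ ≃ 0ᴿ → v ≋ 0ⱽ

  module Linear v = IsLinear (linear v)

  congˡ : ∀ {v v′} w → v ≋ v′ → ⟨ v , w ⟩ ≃ ⟨ v′ , w ⟩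
  congˡ {v} {v′} w p = R.trans (symmetric v w) (R.trans (Linear.cong w p) (symmetric w v′))

  -- By invariance `A · v` and `v` differ by a vector orthogonal to every fixed vector.
  fixed-⊥ : ∀ {z} → A · z ≋ z → ∀ v → ⟨ z , A · v ⟩ ≃ ⟨ z , v ⟩
  fixed-⊥ {z} p v = R.trans (congˡ (A · v) (≋-sym p)) (invariant z v)

  -- Pairing the relation with `z` cancels the multiples of `t` and leaves ⟨z, z⟩ = 0. This is the
  -- tool that excludes unipotent parts, in place of an orthogonal complement.
  no-drift : ∀ t {v w z} → ⟨ z , v ⟩ ≃ ⟨ z , w ⟩ → t *ⱽ v ≋ t *ⱽ w +ⱽ z → z ≋ 0ⱽ
  no-drift t {v} {w} {z} same p = definite z (begin
    ⟨ z , z ⟩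
      ≈⟨ solve 3 (λ t s q → q := (t :* s :+ q) :- t :* s) R.refl t ⟨ z , w ⟩ ⟨ z , z ⟩ ⟩
    (t *ᴿ ⟨ z , w ⟩ +ᴿ ⟨ z , z ⟩) +ᴿ -ᴿ (t *ᴿ ⟨ z , w ⟩)    ≈⟨ R.+-congʳ (Linear.linear z t w z) ⟨
    ⟨ z , t *ⱽ w +ⱽ z ⟩ +ᴿ -ᴿ (t *ᴿ ⟨ z , w ⟩)              ≈⟨ R.+-congʳ (Linear.cong z p) ⟨
    ⟨ z , t *ⱽ v ⟩ +ᴿ -ᴿ (t *ᴿ ⟨ z , w ⟩)
      ≈⟨ R.+-cong (Linear.homo-* z t v) (R.-‿cong (R.*-congˡ (R.sym same))) ⟩
    t *ᴿ ⟨ z , v ⟩ +ᴿ -ᴿ (t *ᴿ ⟨ z , v ⟩)                   ≈⟨ R.-‿inverseʳ _ ⟩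
    0ᴿ                                                      ∎)
    where open ≈-Reasoning R.setoid

sum-linear : {ℓ : Fin k → Vector ℝ n → ℝ} → (∀ j → IsLinear (ℓ j)) → IsLinear (λ v → ∑[ j < k ] ℓ j v)
sum-linear {k = k} {ℓ = ℓ} lin = record
  { cong   = λ p → sum-cong-≋ λ j → IsLinear.cong (lin j) p
  ; linear = λ a v w → R.trans (sum-cong-≋ λ j → IsLinear.linear (lin j) a v w)
      (R.trans (∑-distrib-+ (λ j → a *ᴿ ℓ j v) (λ j → ℓ j w))
        (R.+-congʳ (R.sym (*-distribˡ-sum a (λ j → ℓ j v)))))
  }

scale-linear : {ℓ : Vector ℝ n → ℝ} → IsLinear ℓ → ∀ c → IsLinear (λ v → c *ᴿ ℓ v)
scale-linear {ℓ = ℓ} lin c = record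
  { cong   = λ p → R.*-congˡ (IsLinear.cong lin p)
  ; linear = λ a v w → R.trans (R.*-congˡ (IsLinear.linear lin a v w))
      (solve 4 (λ c a p q → c :* (a :* p :+ q) := a :* (c :* p) :+ c :* q) R.refl c a (ℓ v) (ℓ w))
  }

sum-nonNegative : (x : Vector ℝ k) → (∀ j → NonNegative (x j)) → NonNegative (sum x)
sum-nonNegative {zero}  x x≥0 n = ℚₚ.≤-refl
sum-nonNegative {suc k} x x≥0 =
  +-nonNegative {x zero} {sum (tail x)} (x≥0 zero) (sum-nonNegative (tail x) (λ j → x≥0 (suc j)))

sum-nonNegative≃0 : (x : Vector ℝ k) → (∀ j → NonNegative (x j)) → sum x ≃ 0ᴿ → ∀ j → x j ≃ 0ᴿ
sum-nonNegative≃0 x x≥0 p zero    =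
  nonNegative-sum≃0 {x zero} {sum (tail x)} (x≥0 zero) (sum-nonNegative (tail x) (λ j → x≥0 (suc j))) p
sum-nonNegative≃0 x x≥0 p (suc j) = sum-nonNegative≃0 (tail x) (λ j → x≥0 (suc j))
  (nonNegative-sum≃0 {sum (tail x)} {x zero} (sum-nonNegative (tail x) (λ j → x≥0 (suc j))) (x≥0 zero)
    (R.trans (R.+-comm _ _) p)) j

sum-last : ∀ k (f : ℕ → ℝ) → ∑[ j < suc k ] f (toℕ j) ≃ ∑[ j < k ] f (toℕ j) +ᴿ f k
sum-last zero    f = R.+-comm (f 0) 0ᴿ
sum-last (suc k) f = R.trans (R.+-congˡ (sum-last k (λ j → f (suc j)))) (R.sym (R.+-assoc (f 0) _ _))

dot : Vector ℝ n → Vector ℝ n → ℝ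
dot {n} v w = ∑[ i < n ] (v i *ᴿ w i)

-- The average (up to scale) of the standard inner product over the powers of A.
invariantForm : {A : Matrix n} → HasFiniteOrder A → InvariantForm A
invariantForm {n} {A} (m , period) = record
  { ⟨_,_⟩     = λ v w → ∑[ k < suc m ] term v w (toℕ k)
  ; linear    = λ v → sum-linear {k = suc m} λ k → sum-linear {k = n} λ i →
      scale-linear (iter-linear A (toℕ k) i) (iter A (toℕ k) v i)
  ; symmetric = λ v w → sum-cong-≋ {suc m} λ k → sum-cong-≋ {n} λ i →
      R.*-comm (iter A (toℕ k) v i) (iter A (toℕ k) w i)
  ; invariant = invariant
  ; definite  = λ v p i → square≃0 (sum-nonNegative≃0 (λ i → v i *ᴿ v i) (λ i → square-nonNegative (v i))
      (sum-nonNegative≃0 {k = suc m} (λ k → term v v (toℕ k))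
        (λ k → sum-nonNegative _ λ i → square-nonNegative (iter A (toℕ k) v i)) p zero) i)
  }
  where
  term : Vector ℝ n → Vector ℝ n → ℕ → ℝ
  term v w k = dot (iter A k v) (iter A k w)
  invariant : ∀ v w → ∑[ k < suc m ] term (A · v) (A · w) (toℕ k) ≃ ∑[ k < suc m ] term v w (toℕ k)
  invariant v w = begin
    S′                             ≈⟨ solve 2 (λ s t → s := (t :+ s) :- t) R.refl S′ (term v w 0) ⟩
    (term v w 0 +ᴿ S′) +ᴿ -ᴿ term v w 0
      ≈⟨ R.+-congʳ (sum-last (suc m) (term v w)) ⟩
    (S +ᴿ term v w (suc m)) +ᴿ -ᴿ term v w 0
      ≈⟨ R.+-congʳ (R.+-congˡ (sum-cong-≋ {n} λ i → R.*-cong (period v i) (period w i))) ⟩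
    (S +ᴿ term v w 0) +ᴿ -ᴿ term v w 0
      ≈⟨ solve 2 (λ s t → (s :+ t) :- t := s) R.refl S (term v w 0) ⟩
    S                              ∎
    where
    open ≈-Reasoning R.setoid
    S  = ∑[ k < suc m ] term v w (toℕ k)
    S′ = ∑[ k < suc m ] term (A · v) (A · w) (toℕ k)

-- Determinants of matrices of finite order

volume-iter : ∀ (A : Matrix n) k x → volume (λ j → iter A k (x j)) ≃ det A ^ k *ᴿ volume x
volume-iter A zero    x = R.sym (R.*-identityˡ (volume x))
volume-iter A (suc k) x = R.trans (volume-iter A k (λ j → A · x j)) (R.trans (R.*-congˡ (volume-· A x))
  (solve 3 (λ p d q → p :* (d :* q) := (d :* p) :* q) R.refl (det A ^ k) (det A) (volume x)))

-- The geometric sum of the powers of d² times d² - 1 is zero. Using squares makes every term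
-- nonnegative, so the sum, which starts with 1, cannot vanish.
root-of-unity : ∀ m d → d ^ suc m ≃ 1ᴿ → d *ᴿ d ≃ 1ᴿ
root-of-unity m d dᵐ≃1 = ≃-from-0 (*-cancelˡ-≃0 S≄0 (R.trans (R.*-comm _ _) (R.trans (geometric (suc m))
  (R.trans (R.+-congʳ (R.*-cong dᵐ≃1 dᵐ≃1)) (solve 0 (con 1ℚ :* con 1ℚ :- con 1ℚ := con 0ℚ) R.refl)))))
  where
  S : ℕ → ℝ
  S zero    = 0ᴿ
  S (suc k) = 1ᴿ +ᴿ d *ᴿ d *ᴿ S k
  geometric : ∀ k → (d *ᴿ d +ᴿ -ᴿ 1ᴿ) *ᴿ S k ≃ d ^ k *ᴿ d ^ k +ᴿ -ᴿ 1ᴿ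
  geometric zero    = solve 1 (λ d → (d :* d :- con 1ℚ) :* con 0ℚ := con 1ℚ :* con 1ℚ :- con 1ℚ) R.refl d
  geometric (suc k) = R.trans
    (solve 2 (λ d s → (d :* d :- con 1ℚ) :* (con 1ℚ :+ d :* d :* s) :=
      d :* d :* ((d :* d :- con 1ℚ) :* s) :+ (d :* d :- con 1ℚ)) R.refl d (S k))
    (R.trans (R.+-congʳ (R.*-congˡ (geometric k)))
      (solve 2 (λ d p → d :* d :* (p :* p :- con 1ℚ) :+ (d :* d :- con 1ℚ) := (d :* p) :* (d :* p) :- con 1ℚ)
        R.refl d (d ^ k)))
  S≥0 : ∀ k → NonNegative (S k)
  dS≥0 : ∀ k → NonNegative (d *ᴿ d *ᴿ S k)
  S≥0 zero    n = ℚₚ.≤-refl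
  S≥0 (suc k) = +-nonNegative {1ᴿ} {d *ᴿ d *ᴿ S k} (λ _ → ℚₚ.<⇒≤ 0<1) (dS≥0 k)
  dS≥0 k = *-nonNegative {d *ᴿ d} {S k} (square-nonNegative d) (S≥0 k)
  S≄0 : ¬ S (suc m) ≃ 0ᴿ
  S≄0 p = 1≄0 (nonNegative-sum≃0 {1ᴿ} {d *ᴿ d *ᴿ S m} (λ _ → ℚₚ.<⇒≤ 0<1) (dS≥0 m) p)

det²≃1 : {A : Matrix n} → HasFiniteOrder A → det A *ᴿ det A ≃ 1ᴿ
det²≃1 {n} {A} (m , period) = root-of-unity m (det A) (begin
  det A ^ suc m                              ≈⟨ R.*-identityʳ _ ⟨
  det A ^ suc m *ᴿ 1ᴿ                        ≈⟨ R.*-congˡ (volume-1ᴹ {n}) ⟨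
  det A ^ suc m *ᴿ volume (1ᴹ {n})           ≈⟨ volume-iter A (suc m) 1ᴹ ⟨
  volume (λ j → iter A (suc m) (1ᴹ j))
    ≈⟨ IsAlternating.cong (volume-alternating {n}) (λ j → period (1ᴹ j)) ⟩
  volume (1ᴹ {n})                            ≈⟨ volume-1ᴹ {n} ⟩
  1ᴿ                                         ∎)
  where open ≈-Reasoning R.setoid

-- Fixed spaces of codimension one and two

-- `B` will be the volume as a function of the two free slots, and the `w`s the remainders in the
-- fixed space: they drop out, leaving the determinant of the 2×2 block.
bilinear-2×2 : (B : Vector ℝ n → Vector ℝ n → ℝ) →
  (∀ w → IsLinear (λ v → B v w)) → (∀ v → IsLinear (B v)) → (∀ v → B v v ≃ 0ᴿ) →
  ∀ {w₁ w₂} → (∀ v → B w₁ v ≃ 0ᴿ) → (∀ v → B v w₂ ≃ 0ᴿ) → ∀ a b c e u₁ u₂ →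
  B (a *ⱽ u₁ +ⱽ (b *ⱽ u₂ +ⱽ w₁)) (c *ⱽ u₁ +ⱽ (e *ⱽ u₂ +ⱽ w₂)) ≃ (a *ᴿ e +ᴿ -ᴿ (b *ᴿ c)) *ᴿ B u₁ u₂
bilinear-2×2 B linˡ linʳ diag {w₁} {w₂} w₁≃0 w₂≃0 a b c e u₁ u₂ = begin
  B (a *ⱽ u₁ +ⱽ (b *ⱽ u₂ +ⱽ w₁)) v
    ≈⟨ expand (linˡ v) a b (w₁≃0 v) ⟩
  a *ᴿ B u₁ v +ᴿ b *ᴿ B u₂ v
    ≈⟨ R.+-cong (R.*-congˡ (expand (linʳ u₁) c e (w₂≃0 u₁))) (R.*-congˡ (expand (linʳ u₂) c e (w₂≃0 u₂))) ⟩
  a *ᴿ (c *ᴿ B u₁ u₁ +ᴿ e *ᴿ B u₁ u₂) +ᴿ b *ᴿ (c *ᴿ B u₂ u₁ +ᴿ e *ᴿ B u₂ u₂)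
    ≈⟨ R.+-cong (R.*-congˡ (R.+-congʳ (R.*-congˡ (diag u₁))))
         (R.*-congˡ (R.+-cong (R.*-congˡ (bilinear-antisymmetric B linˡ linʳ diag u₂ u₁)) (R.*-congˡ (diag u₂)))) ⟩
  a *ᴿ (c *ᴿ 0ᴿ +ᴿ e *ᴿ B u₁ u₂) +ᴿ b *ᴿ (c *ᴿ -ᴿ B u₁ u₂ +ᴿ e *ᴿ 0ᴿ)
    ≈⟨ solve 5 (λ a b c e p → a :* (c :* con 0ℚ :+ e :* p) :+ b :* (c :* (:- p) :+ e :* con 0ℚ) := (a :* e :- b :* c) :* p)
         R.refl a b c e (B u₁ u₂) ⟩
  (a *ᴿ e +ᴿ -ᴿ (b *ᴿ c)) *ᴿ B u₁ u₂ ∎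
  where
  open ≈-Reasoning R.setoid
  v = c *ⱽ u₁ +ⱽ (e *ⱽ u₂ +ⱽ w₂)
  expand : ∀ {ℓ w} → IsLinear ℓ → ∀ a b → ℓ w ≃ 0ᴿ → ℓ (a *ⱽ u₁ +ⱽ (b *ⱽ u₂ +ⱽ w)) ≃ a *ᴿ ℓ u₁ +ᴿ b *ᴿ ℓ u₂
  expand lin a b p = R.trans (IsLinear.linear lin a _ _)
    (R.+-congˡ (R.trans (IsLinear.linear lin b _ _) (R.trans (R.+-congˡ p) (R.+-identityʳ _))))

module _ {W : Subspace n} {b : Vector (Vector ℝ n) k} (isBasis : IsBasis W b) (F : Frame c b) where
  open Frame F

  -- `w` is a combination of vectors that already occupy the bound slots. A general `x` is allowed
  -- because in codimension two the other free slot has been overwritten.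
  volume-dependent : ∀ x → (∀ i → x (bound i) ≋ b i) → ∀ l {w} → w ∈ ⟦ W ⟧ⱽ → volume (x [ free l ≔ w ]) ≃ 0ᴿ
  volume-dependent x x-bound l {w} w∈W with IsBasis.spanning isBasis w∈W
  ... | a , w≋ = R.trans (S.cong w≋) (R.trans (S.homo-linComb a b) (sum-zero λ i →
          R.trans (R.*-congˡ (repeated volume-alternating (x [ free l ≔ b i ]) (free≢bound l i) (same i))) (R.zeroʳ _)))
    where
    module S = IsLinear (Alternating.slot (volume-alternating {n}) x (free l))
    same : ∀ i → (x [ free l ≔ b i ]) (free l) ≋ (x [ free l ≔ b i ]) (bound i)
    same i r = R.trans (R.reflexive (≡.cong (_$ r) (updateAt-updates (free l) x)))
      (R.sym (replace-free x x-bound l (b i) i r))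

module _ {W : Subspace n} {b : Vector (Vector ℝ n) k} (isBasis : IsBasis W b)
  (A : Matrix n) (fixed : ∀ {w} → w ∈ ⟦ W ⟧ⱽ → A · w ≋ w) where

  private
    module Vol = Alternating (volume-alternating {n})

    fixed-bound : (F : Frame c b) → ∀ i → A · Frame.basis F (Frame.bound F i) ≋ Frame.basis F (Frame.bound F i)
    fixed-bound F i = fixed (Subspace.resp W (≋-sym (Frame.basis-bound F i)) (IsBasis.member isBasis i))

    updated : ∀ (x : Vector (Vector ℝ n) n) j {v} → (x [ j ≔ v ]) j ≋ v
    updated x j r = R.reflexive (≡.cong (_$ r) (updateAt-updates j x))

    kept : ∀ (x : Vector (Vector ℝ n) n) i j {v} → i ≢ j → (x [ j ≔ v ]) i ≋ x i
    kept x i j i≢j r = R.reflexive (≡.cong (_$ r) (updateAt-minimal i j x i≢j))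

  module _ (F : Frame 1 b) where
    open Frame F
    private u = basis (free zero)

    -- In the frame `A` is block triangular with the identity on `W`, so its determinant is its
    -- scalar on the quotient line; `δ` is the denominator of that scalar.
    det-codim1 : ∀ δ a {w} → w ∈ ⟦ W ⟧ⱽ → δ *ⱽ A · u ≋ a *ⱽ u +ⱽ w → δ *ᴿ det A ≃ a
    det-codim1 δ a {w} w∈W p = *-cancelˡ nondegenerate (begin
      X *ᴿ (δ *ᴿ det A)
        ≈⟨ solve 3 (λ x δ d → x :* (δ :* d) := δ :* (d :* x)) R.refl X δ (det A) ⟩
      δ *ᴿ (det A *ᴿ X)
        ≈⟨ R.*-congˡ (R.trans (R.sym (volume-· A basis)) (Vol.cong λ j → columns j (cover j))) ⟩
      δ *ᴿ volume (basis [ free zero ≔ A · u ])     ≈⟨ S.homo-* δ (A · u) ⟨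
      volume (basis [ free zero ≔ δ *ⱽ A · u ])     ≈⟨ S.cong p ⟩
      volume (basis [ free zero ≔ a *ⱽ u +ⱽ w ])    ≈⟨ S.linear a u w ⟩
      a *ᴿ volume (basis [ free zero ≔ u ]) +ᴿ volume (basis [ free zero ≔ w ])
        ≈⟨ R.+-cong (R.*-congˡ (Vol.cong-≗ (updateAt-id-local (free zero) basis ≡.refl)))
             (volume-dependent isBasis F basis basis-bound zero w∈W) ⟩
      a *ᴿ X +ᴿ 0ᴿ
        ≈⟨ solve 2 (λ a x → a :* x :+ con 0ℚ := x :* a) R.refl a X ⟩
      X *ᴿ a                                        ∎)
      where
      open ≈-Reasoning R.setoid
      X = volume basis
      module S = IsLinear (Vol.slot basis (free zero))
      columns : ∀ j → (∃ λ i → free i ≡ j) ⊎ (∃ λ i → bound i ≡ j) →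
        A · basis j ≋ (basis [ free zero ≔ A · u ]) j
      columns _ (inj₁ (zero , ≡.refl)) = ≋-sym (updated basis (free zero))
      columns _ (inj₂ (i , ≡.refl))    = ≋-trans (fixed-bound F i)
        (≋-sym (kept basis (bound i) (free zero) λ p → free≢bound zero i (≡.sym p)))

  module _ (F : Frame 2 b) where
    open Frame F
    private
      i₁ = free zero
      i₂ = free (suc zero)
      u₁ = basis i₁
      u₂ = basis i₂
      i₁≢i₂ : i₁ ≢ i₂
      i₁≢i₂ p with free-injective p
      ... | ()

    -- Again block triangular with the identity on `W`; each of the two rows of the block
    -- contributes one denominator `δ`.
    det-codim2 : ∀ δ a b c e {w₁ w₂} → w₁ ∈ ⟦ W ⟧ⱽ → w₂ ∈ ⟦ W ⟧ⱽ →
      δ *ⱽ A · u₁ ≋ a *ⱽ u₁ +ⱽ (b *ⱽ u₂ +ⱽ w₁) → δ *ⱽ A · u₂ ≋ c *ⱽ u₁ +ⱽ (e *ⱽ u₂ +ⱽ w₂) →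
      δ *ᴿ (δ *ᴿ det A) ≃ a *ᴿ e +ᴿ -ᴿ (b *ᴿ c)
    det-codim2 δ a b c e {w₁} {w₂} w₁∈W w₂∈W p₁ p₂ = *-cancelˡ nondegenerate (begin
      X *ᴿ (δ *ᴿ (δ *ᴿ det A))
        ≈⟨ solve 3 (λ x δ d → x :* (δ :* (δ :* d)) := δ :* (δ :* (d :* x))) R.refl X δ (det A) ⟩
      δ *ᴿ (δ *ᴿ (det A *ᴿ X))
        ≈⟨ R.*-congˡ (R.*-congˡ (R.trans (R.sym (volume-· A basis)) (Vol.cong λ j → columns j (cover j)))) ⟩
      δ *ᴿ (δ *ᴿ B (A · u₁) (A · u₂))
        ≈⟨ R.*-congˡ (IsLinear.homo-* (linʳ (A · u₁)) δ (A · u₂)) ⟨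
      δ *ᴿ B (A · u₁) (δ *ⱽ A · u₂)                   ≈⟨ IsLinear.homo-* (linˡ (δ *ⱽ A · u₂)) δ (A · u₁) ⟨
      B (δ *ⱽ A · u₁) (δ *ⱽ A · u₂)
        ≈⟨ R.trans (IsLinear.cong (linˡ _) p₁) (IsLinear.cong (linʳ _) p₂) ⟩
      B (a *ⱽ u₁ +ⱽ (b *ⱽ u₂ +ⱽ w₁)) (c *ⱽ u₁ +ⱽ (e *ⱽ u₂ +ⱽ w₂))
        ≈⟨ bilinear-2×2 B linˡ linʳ diag w₁-kills w₂-kills a b c e u₁ u₂ ⟩
      (a *ᴿ e +ᴿ -ᴿ (b *ᴿ c)) *ᴿ B u₁ u₂              ≈⟨ R.*-congˡ (Vol.cong-≗ unchanged) ⟩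
      (a *ᴿ e +ᴿ -ᴿ (b *ᴿ c)) *ᴿ X                    ≈⟨ R.*-comm _ X ⟩
      X *ᴿ (a *ᴿ e +ᴿ -ᴿ (b *ᴿ c))                    ∎)
      where
      open ≈-Reasoning R.setoid
      X = volume basis
      B : Vector ℝ n → Vector ℝ n → ℝ
      B s t = volume (basis [ i₁ ≔ s ] [ i₂ ≔ t ])
      swapped : ∀ s t → B s t ≃ volume (basis [ i₂ ≔ t ] [ i₁ ≔ s ])
      swapped s t = Vol.cong-≗ (updateAt-commutes i₂ i₁ (λ p → i₁≢i₂ (≡.sym p)) basis)
      linʳ : ∀ s → IsLinear (B s)
      linʳ s = Vol.slot (basis [ i₁ ≔ s ]) i₂
      linˡ : ∀ t → IsLinear (λ s → B s t)
      linˡ t = record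
        { cong   = λ {v} {w} p → R.trans (swapped v t) (R.trans (S.cong p) (R.sym (swapped w t)))
        ; linear = λ a v w → R.trans (swapped _ t) (R.trans (S.linear a v w)
            (R.sym (R.+-cong (R.*-congˡ (swapped v t)) (swapped w t))))
        }
        where module S = IsLinear (Vol.slot (basis [ i₂ ≔ t ]) i₁)
      diag : ∀ s → B s s ≃ 0ᴿ
      diag s = repeated volume-alternating _ i₁≢i₂
        (≋-trans (kept (basis [ i₁ ≔ s ]) i₁ i₂ i₁≢i₂) (≋-trans (updated basis i₁) (≋-sym (updated (basis [ i₁ ≔ s ]) i₂))))
      w₁-kills : ∀ v → B w₁ v ≃ 0ᴿ
      w₁-kills v = R.trans (swapped w₁ v) (volume-dependent isBasis F (basis [ i₂ ≔ v ])
        (replace-free basis basis-bound (suc zero) v) zero w₁∈W)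
      w₂-kills : ∀ v → B v w₂ ≃ 0ᴿ
      w₂-kills v = volume-dependent isBasis F (basis [ i₁ ≔ v ])
        (replace-free basis basis-bound zero v) (suc zero) w₂∈W
      unchanged : ∀ j → (basis [ i₁ ≔ u₁ ] [ i₂ ≔ u₂ ]) j ≡ basis j
      unchanged j = ≡.trans (updateAt-id-local i₂ (basis [ i₁ ≔ u₁ ])
          (≡.sym (updateAt-minimal i₂ i₁ basis λ p → i₁≢i₂ (≡.sym p))) j)
        (updateAt-id-local i₁ basis ≡.refl j)
      columns : ∀ j → (∃ λ i → free i ≡ j) ⊎ (∃ λ i → bound i ≡ j) →
        A · basis j ≋ (basis [ i₁ ≔ A · u₁ ] [ i₂ ≔ A · u₂ ]) j
      columns _ (inj₁ (zero , ≡.refl))     = ≋-sym (≋-trans (kept _ i₁ i₂ i₁≢i₂) (updated basis i₁))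
      columns _ (inj₁ (suc zero , ≡.refl)) = ≋-sym (updated (basis [ i₁ ≔ A · u₁ ]) i₂)
      columns _ (inj₂ (i , ≡.refl))        = ≋-trans (fixed-bound F i) (≋-sym (≋-trans
        (kept _ (bound i) i₂ λ p → free≢bound (suc zero) i (≡.sym p))
        (kept basis (bound i) i₁ λ p → free≢bound zero i (≡.sym p))))

-- Displacements, and involutions from determinant -1

+ⱽ-swap : (u v w : Vector ℝ n) → u +ⱽ (v +ⱽ w) ≋ v +ⱽ (u +ⱽ w)
+ⱽ-swap u v w i = solve 3 (λ p q r → p :+ (q :+ r) := q :+ (p :+ r)) R.refl (u i) (v i) (w i)

module _ {A : Matrix n} where

  displacement : Vector ℝ n → Vector ℝ n
  displacement u = A · u +ⱽ (-ᴿ 1ᴿ) *ⱽ u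

  ·-displacement : ∀ u → A · displacement u ≋ A · A · u +ⱽ (-ᴿ 1ᴿ) *ⱽ A · u
  ·-displacement u i = R.trans (·-+ A (A · u) _ i) (R.+-congˡ (·-* A (-ᴿ 1ᴿ) u i))

  -- A - 1 commutes with `A`; applied to the relation it kills the fixed remainder `w`, so the block
  -- acts on displacements exactly.
  displacement-image : ∀ {δ a b u u′ w} → A · w ≋ w → δ *ⱽ A · u ≋ a *ⱽ u +ⱽ (b *ⱽ u′ +ⱽ w) →
    δ *ⱽ A · displacement u ≋ a *ⱽ displacement u +ⱽ b *ⱽ displacement u′
  displacement-image {δ} {a} {b} {u} {u′} {w} w-fixed p i = begin
    δ *ᴿ (A · displacement u) i
      ≈⟨ R.*-congˡ (·-displacement u i) ⟩
    δ *ᴿ ((A · A · u) i +ᴿ (-ᴿ 1ᴿ) *ᴿ (A · u) i)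
      ≈⟨ solve 3 (λ d p q → d :* (p :+ (:- con 1ℚ) :* q) := d :* p :- d :* q) R.refl δ _ _ ⟩
    δ *ᴿ (A · A · u) i +ᴿ -ᴿ (δ *ᴿ (A · u) i)
      ≈⟨ R.+-cong image (R.-‿cong (p i)) ⟩
    (a *ᴿ (A · u) i +ᴿ (b *ᴿ (A · u′) i +ᴿ w i)) +ᴿ -ᴿ (a *ᴿ u i +ᴿ (b *ᴿ u′ i +ᴿ w i))
      ≈⟨ solve 7 (λ a b p q r s w → (a :* p :+ (b :* q :+ w)) :- (a :* r :+ (b :* s :+ w)) :=
           a :* (p :+ (:- con 1ℚ) :* r) :+ b :* (q :+ (:- con 1ℚ) :* s)) R.refl a b _ _ (u i) (u′ i) (w i) ⟩
    a *ᴿ displacement u i +ᴿ b *ᴿ displacement u′ i ∎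
    where
    open ≈-Reasoning R.setoid
    module L = IsLinear (·-linear A i)
    image : δ *ᴿ (A · A · u) i ≃ a *ᴿ (A · u) i +ᴿ (b *ᴿ (A · u′) i +ᴿ w i)
    image = R.trans (R.sym (L.homo-* δ (A · u))) (R.trans (L.cong p) (R.trans (L.linear a u _)
      (R.+-congˡ (R.trans (L.linear b u′ w) (R.+-congˡ (w-fixed i))))))

  -- After one more application of `δA`, the term in `v₂` is eliminated through the first relation,
  -- which leaves the trace and the determinant of the block.
  cayley-hamilton : ∀ {δ a b c e v₁ v₂} → δ *ⱽ A · v₁ ≋ a *ⱽ v₁ +ⱽ b *ⱽ v₂ → δ *ⱽ A · v₂ ≋ c *ⱽ v₁ +ⱽ e *ⱽ v₂ →
    δ *ⱽ δ *ⱽ A · A · v₁ ≋ (a +ᴿ e) *ⱽ δ *ⱽ A · v₁ +ⱽ (-ᴿ (a *ᴿ e +ᴿ -ᴿ (b *ᴿ c))) *ⱽ v₁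
  cayley-hamilton {δ} {a} {b} {c} {e} {v₁} {v₂} p q i = begin
    δ *ᴿ (δ *ᴿ (A · A · v₁) i)
      ≈⟨ R.*-congˡ (R.trans (R.sym (L.homo-* δ (A · v₁))) (R.trans (L.cong p)
           (R.trans (L.linear a v₁ _) (R.+-congˡ (L.homo-* b v₂))))) ⟩
    δ *ᴿ (a *ᴿ (A · v₁) i +ᴿ b *ᴿ (A · v₂) i)
      ≈⟨ solve 5 (λ d a b p q → d :* (a :* p :+ b :* q) := a :* (d :* p) :+ b :* (d :* q)) R.refl δ a b _ _ ⟩
    a *ᴿ (δ *ᴿ (A · v₁) i) +ᴿ b *ᴿ (δ *ᴿ (A · v₂) i)
      ≈⟨ R.+-congˡ (R.*-congˡ (q i)) ⟩
    a *ᴿ (δ *ᴿ (A · v₁) i) +ᴿ b *ᴿ (c *ᴿ v₁ i +ᴿ e *ᴿ v₂ i)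
      ≈⟨ solve 7 (λ a b c e p v w → a :* p :+ b :* (c :* v :+ e :* w) :=
           (a :* p :+ e :* (a :* v :+ b :* w)) :+ (:- (a :* e :- b :* c)) :* v) R.refl a b c e _ (v₁ i) (v₂ i) ⟩
    (a *ᴿ (δ *ᴿ (A · v₁) i) +ᴿ e *ᴿ (a *ᴿ v₁ i +ᴿ b *ᴿ v₂ i)) +ᴿ -ᴿ Δ *ᴿ v₁ i
      ≈⟨ R.+-congʳ (R.+-congˡ (R.*-congˡ (p i))) ⟨
    (a *ᴿ (δ *ᴿ (A · v₁) i) +ᴿ e *ᴿ (δ *ᴿ (A · v₁) i)) +ᴿ -ᴿ Δ *ᴿ v₁ i
      ≈⟨ R.+-congʳ (R.distribʳ _ a e) ⟨
    (a +ᴿ e) *ᴿ (δ *ᴿ (A · v₁) i) +ᴿ -ᴿ Δ *ᴿ v₁ i ∎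
    where
    open ≈-Reasoning R.setoid
    Δ = a *ᴿ e +ᴿ -ᴿ (b *ᴿ c)
    module L = IsLinear (·-linear A i)

  module _ (form : InvariantForm A) where
    open InvariantForm form

    -- δ A² v = τ A v + δ v says that A − A⁻¹ is the scalar τ/δ on v; pairing with A v shows that τ = 0 or A v = 0.
    skew⇒involutive : ∀ {δ τ v} → ¬ δ ≃ 0ᴿ → δ *ⱽ A · A · v ≋ τ *ⱽ A · v +ⱽ δ *ⱽ v → A · A · v ≋ v
    skew⇒involutive {δ} {τ} {v} δ≄0 p i = *-cancelˡ δ≄0 (R.trans (p i) (R.trans (R.+-congʳ (τAv≋0 i)) (R.+-identityˡ _)))
      where
      open ≈-Reasoning R.setoid
      Av = A · v
      module L = Linear Av
      τ⟨Av,Av⟩≃0 : τ *ᴿ ⟨ Av , Av ⟩ ≃ 0ᴿ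
      τ⟨Av,Av⟩≃0 = begin
        τ *ᴿ ⟨ Av , Av ⟩
          ≈⟨ solve 2 (λ p q → p := (p :+ q) :- q) R.refl _ (δ *ᴿ ⟨ Av , v ⟩) ⟩
        (τ *ᴿ ⟨ Av , Av ⟩ +ᴿ δ *ᴿ ⟨ Av , v ⟩) +ᴿ -ᴿ (δ *ᴿ ⟨ Av , v ⟩)
          ≈⟨ R.+-congʳ (R.trans (L.linear τ Av (δ *ⱽ v)) (R.+-congˡ (L.homo-* δ v))) ⟨
        ⟨ Av , τ *ⱽ Av +ⱽ δ *ⱽ v ⟩ +ᴿ -ᴿ (δ *ᴿ ⟨ Av , v ⟩)
          ≈⟨ R.+-congʳ (R.trans (R.sym (L.homo-* δ (A · Av))) (L.cong p)) ⟨
        δ *ᴿ ⟨ Av , A · Av ⟩ +ᴿ -ᴿ (δ *ᴿ ⟨ Av , v ⟩)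
          ≈⟨ R.+-congʳ (R.*-congˡ (R.trans (invariant v Av) (symmetric v Av))) ⟩
        δ *ᴿ ⟨ Av , v ⟩ +ᴿ -ᴿ (δ *ᴿ ⟨ Av , v ⟩)
          ≈⟨ R.-‿inverseʳ _ ⟩
        0ᴿ ∎
      τAv≋0 : τ *ⱽ Av ≋ 0ⱽ
      τAv≋0 = definite _ (begin
        ⟨ τ *ⱽ Av , τ *ⱽ Av ⟩      ≈⟨ Linear.homo-* (τ *ⱽ Av) τ Av ⟩
        τ *ᴿ ⟨ τ *ⱽ Av , Av ⟩
          ≈⟨ R.*-congˡ (R.trans (symmetric _ _) (R.trans (L.homo-* τ Av) τ⟨Av,Av⟩≃0)) ⟩
        τ *ᴿ 0ᴿ                    ≈⟨ R.zeroʳ τ ⟩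
        0ᴿ                         ∎)

    -- The vector z = A²u - u is fixed, so A² moves `u` by a fixed vector, and `no-drift` makes that
    -- vector zero.
    involutive-displacement : ∀ u → A · A · displacement u ≋ displacement u → A · A · u ≋ u
    involutive-displacement u p i = R.trans (AAu i) (R.trans (R.+-congˡ (z≋0 i)) (R.+-identityʳ (u i)))
      where
      v = displacement u
      z = A · v +ⱽ v
      z-fixed : A · z ≋ z
      z-fixed j = R.trans (·-+ A (A · v) v j) (R.trans (R.+-congʳ (p j)) (R.+-comm _ _))
      AAu : A · A · u ≋ u +ⱽ z
      AAu j = R.trans (solve 3 (λ p q r → p := r :+ ((p :+ (:- con 1ℚ) :* q) :+ (q :+ (:- con 1ℚ) :* r))) R.refl _ ((A · u) j) (u j))
        (R.+-congˡ (R.+-congʳ (R.sym (·-displacement u j))))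
      z≋0 : z ≋ 0ⱽ
      z≋0 = no-drift 1ᴿ {A · A · u} {u}
        (R.trans (fixed-⊥ z-fixed (A · u)) (fixed-⊥ z-fixed u))
        λ j → R.trans (R.*-identityˡ _) (R.trans (AAu j) (R.+-congʳ (R.sym (R.*-identityˡ _))))

    -- With block determinant -δ², Cayley-Hamilton on the displacement of `u₁` is, after cancelling
    -- one `δ`, the relation required by `skew⇒involutive`.
    negative-block⇒involutive : ∀ {δ a b c e u₁ u₂ w₁ w₂} → ¬ δ ≃ 0ᴿ → A · w₁ ≋ w₁ → A · w₂ ≋ w₂ →
      δ *ⱽ A · u₁ ≋ a *ⱽ u₁ +ⱽ (b *ⱽ u₂ +ⱽ w₁) → δ *ⱽ A · u₂ ≋ c *ⱽ u₁ +ⱽ (e *ⱽ u₂ +ⱽ w₂) →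
      δ *ᴿ (δ *ᴿ -ᴿ 1ᴿ) ≃ a *ᴿ e +ᴿ -ᴿ (b *ᴿ c) → A · A · u₁ ≋ u₁
    negative-block⇒involutive {δ} {a} {b} {c} {e} {u₁} {u₂} δ≄0 w₁-fixed w₂-fixed p₁ p₂ Δ =
      involutive-displacement u₁ (skew⇒involutive {δ} {a +ᴿ e} δ≄0 λ i → *-cancelˡ δ≄0
        (R.trans (cayley-hamilton {δ} {a} {b} {c} {e} {displacement u₁} {displacement u₂}
            (displacement-image w₁-fixed p₁)
            (λ j → R.trans (displacement-image {δ} {e} {c} w₂-fixed (≋-trans p₂ (+ⱽ-swap (c *ⱽ u₁) (e *ⱽ u₂) _)) j)
              (R.+-comm _ _)) i)
          (R.trans (R.+-congˡ (R.*-congʳ (R.-‿cong (R.sym Δ))))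
            (solve 4 (λ d t p v → t :* (d :* p) :+ (:- (d :* (d :* (:- con 1ℚ)))) :* v := d :* (t :* p :+ d :* v)) R.refl
              δ (a +ᴿ e) _ (displacement u₁ i)))))

span-two : (W : Subspace n) (x : Vector (Vector ℝ n) 2) → ∀ {v} → v ∈ ⟦ W +span x ⟧ⱽ →
  ∃ λ a → ∃ λ b → ∃ λ w → w ∈ ⟦ W ⟧ⱽ × v ≋ a *ⱽ x zero +ⱽ (b *ⱽ x (suc zero) +ⱽ w)
span-two W x (a , w , w∈W , p) = a zero , a (suc zero) , w , w∈W , λ i → R.trans (p i)
  (solve 3 (λ p q w → (p :+ (q :+ con 0ℚ)) :+ w := p :+ (q :+ w)) R.refl _ _ (w i))

span-one : (W : Subspace n) (x : Vector (Vector ℝ n) 1) → ∀ {v} → v ∈ ⟦ W +span x ⟧ⱽ →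
  ∃ λ a → ∃ λ w → w ∈ ⟦ W ⟧ⱽ × v ≋ a *ⱽ x zero +ⱽ w
span-one W x (a , w , w∈W , p) = a zero , w , w∈W , λ i → R.trans (p i)
  (R.+-congʳ (R.+-identityʳ _))

codim2⇒det≃1 : (g : GL n) → HasFiniteOrder (mat g) → HasCodim V^⟨ g ⟩ 2 → det (mat g) ≃ 1ᴿ
codim2⇒det≃1 g finite (k , (b , isBasis) , k+2≡n) = ≃-stable λ d≄1 →
  frame (≡.trans (ℕₚ.+-comm 2 k) k+2≡n) b (IsBasis.independent isBasis) λ F → d≄1 (d≃1 d≄1 F)
  where
  A = mat g
  form = invariantForm finite
  module _ (d≄1 : ¬ det A ≃ 1ᴿ) where
    d≃-1 : det A ≃ -ᴿ 1ᴿ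
    -- (d - 1)(d + 1) = d² - 1 vanishes and its first factor is nonzero by assumption.
    d≃-1 = ≃-from-0 (*-cancelˡ-≃0 (λ p → d≄1 (≃-from-0 p))
      (R.trans (solve 1 (λ d → (d :- con 1ℚ) :* (d :- (:- con 1ℚ)) := d :* d :- con 1ℚ) R.refl (det A))
        (R.trans (R.+-congʳ (det²≃1 finite)) (R.-‿inverseʳ 1ᴿ))))
    module _ (F : Frame 2 b) where
      open Frame F
      δ = volume basis
      u : Vector (Vector ℝ _) 2
      u j = basis (free j)
      image : ∀ j → ∃ λ a → ∃ λ b → ∃ λ w → A · w ≋ w × δ *ⱽ A · u j ≋ a *ⱽ u zero +ⱽ (b *ⱽ u (suc zero) +ⱽ w)
      image j = span-two V^⟨ g ⟩ u (decompose V^⟨ g ⟩ (IsBasis.member isBasis) (A · u j))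
      -- Once A² fixes `u j`, the sum of `u j` and its image is fixed, so `A` acts as -1 modulo
      -- fixed vectors.
      reflected : ∀ j → A · A · u j ≋ u j → ∃ λ w → A · w ≋ w × A · u j ≋ (-ᴿ 1ᴿ) *ⱽ u j +ⱽ w
      reflected j p = A · u j +ⱽ u j
        , (λ i → R.trans (·-+ A (A · u j) (u j) i) (R.trans (R.+-congʳ (p i)) (R.+-comm _ _)))
        , λ i → solve 2 (λ p q → p := (:- con 1ℚ) :* q :+ (p :+ q)) R.refl _ (u j i)
      reflections : (∃ λ w → A · w ≋ w × A · u zero ≋ (-ᴿ 1ᴿ) *ⱽ u zero +ⱽ w) →
        (∃ λ w → A · w ≋ w × A · u (suc zero) ≋ (-ᴿ 1ᴿ) *ⱽ u (suc zero) +ⱽ w) → det A ≃ 1ᴿ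
      reflections (z₁ , z₁-fixed , q₁) (z₂ , z₂-fixed , q₂) = R.trans
        (solve 1 (λ d → d := con 1ℚ :* (con 1ℚ :* d)) R.refl (det A))
        -- The block is now minus the identity with denominator 1, and the sign disappears in
        -- dimension two.
        (R.trans (det-codim2 isBasis A id F 1ᴿ (-ᴿ 1ᴿ) 0ᴿ 0ᴿ (-ᴿ 1ᴿ) z₁-fixed z₂-fixed
          (λ i → R.trans (R.*-identityˡ _) (R.trans (q₁ i)
            (solve 3 (λ p q r → p :+ r := p :+ (con 0ℚ :* q :+ r)) R.refl ((-ᴿ 1ᴿ) *ᴿ u zero i) (u (suc zero) i) (z₁ i))))
          (λ i → R.trans (R.*-identityˡ _) (R.trans (q₂ i)
            (solve 3 (λ p q r → p :+ r := con 0ℚ :* q :+ (p :+ r)) R.refl ((-ᴿ 1ᴿ) *ᴿ u (suc zero) i) (u zero i) (z₂ i)))))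
          (solve 0 ((:- con 1ℚ) :* (:- con 1ℚ) :- con 0ℚ :* con 0ℚ := con 1ℚ) R.refl))
      Image : Fin 2 → Set
      Image j = ∃ λ a → ∃ λ b → ∃ λ w → A · w ≋ w × δ *ⱽ A · u j ≋ a *ⱽ u zero +ⱽ (b *ⱽ u (suc zero) +ⱽ w)
      conclude : Image zero → Image (suc zero) → det A ≃ 1ᴿ
      conclude (a , b , w₁ , w₁-fixed , p₁) (c , e , w₂ , w₂-fixed , p₂) = reflections
        (reflected zero (negative-block⇒involutive form {δ} {a} {b} {c} {e} {u zero} {u (suc zero)} {w₁} {w₂}
          nondegenerate w₁-fixed w₂-fixed p₁ p₂ Δ₁))
        -- Exchanging the two free vectors conjugates the block by a transposition, which preserves
        -- its determinant.
        (reflected (suc zero) (negative-block⇒involutive form {δ} {e} {c} {b} {a} {u (suc zero)} {u zero} {w₂} {w₁}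
          nondegenerate w₂-fixed w₁-fixed
          (≋-trans p₂ (+ⱽ-swap (c *ⱽ u zero) (e *ⱽ u (suc zero)) w₂))
          (≋-trans p₁ (+ⱽ-swap (a *ⱽ u zero) (b *ⱽ u (suc zero)) w₁))
          (R.trans Δ₁ (solve 4 (λ a b c e → a :* e :- b :* c := e :* a :- c :* b) R.refl a b c e))))
        where
        Δ₁ : δ *ᴿ (δ *ᴿ -ᴿ 1ᴿ) ≃ a *ᴿ e +ᴿ -ᴿ (b *ᴿ c)
        Δ₁ = R.trans (R.*-congˡ (R.*-congˡ (R.sym d≃-1)))
          (det-codim2 isBasis A id F δ a b c e w₁-fixed w₂-fixed p₁ p₂)
      d≃1 : det A ≃ 1ᴿ
      d≃1 = conclude (image zero) (image (suc zero))

codim1-det≃1⇒≈1 : (A : Matrix n) → HasFiniteOrder A → {W : Subspace n} → HasCodim W 1 →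
  (∀ {w} → w ∈ ⟦ W ⟧ⱽ → A · w ≋ w) → det A ≃ 1ᴿ → A ≃ᴹ 1ᴹ
codim1-det≃1⇒≈1 {n} A finite {W} (k , (b , isBasis) , k+1≡n) fixed d≃1 i j = ≃-stable λ ≄ →
  frame (≡.trans (ℕₚ.+-comm 1 k) k+1≡n) b (IsBasis.independent isBasis) λ F → ≄ (entry F)
  where
  form = invariantForm finite
  module _ (F : Frame 1 b) where
    open Frame F
    δ = volume basis
    u : Vector (Vector ℝ n) 1
    u j = basis (free j)
    u-fixed : (∃ λ a → ∃ λ w → w ∈ ⟦ W ⟧ⱽ × δ *ⱽ A · u zero ≋ a *ⱽ u zero +ⱽ w) → A · u zero ≋ u zero
    u-fixed (a , w , w∈W , p) i = *-cancelˡ nondegenerate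
      (R.trans (drift i) (R.trans (R.+-congˡ (w≋0 i)) (R.+-identityʳ _)))
      where
      δ≃a : δ ≃ a
      δ≃a = R.trans (R.sym (R.*-identityʳ δ)) (R.trans (R.*-congˡ (R.sym d≃1))
        (det-codim1 isBasis A fixed F δ a w∈W p))
      -- As the scalar on the quotient line is 1, `w` is the unipotent part of `A`, up to the factor
      -- `δ`.
      drift : δ *ⱽ A · u zero ≋ δ *ⱽ u zero +ⱽ w
      drift i = R.trans (p i) (R.+-congʳ (R.*-congʳ (R.sym δ≃a)))
      w≋0 : w ≋ 0ⱽ
      w≋0 = InvariantForm.no-drift form δ (InvariantForm.fixed-⊥ form (fixed w∈W) (u zero)) drift
    basis-fixed : ∀ j → (∃ λ i → free i ≡ j) ⊎ (∃ λ i → bound i ≡ j) → A · basis j ≋ basis j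
    basis-fixed _ (inj₁ (zero , ≡.refl)) =
      u-fixed (span-one W u (decompose W (IsBasis.member isBasis) (A · u zero)))
    basis-fixed _ (inj₂ (i , ≡.refl))    = fixed (Subspace.resp W (≋-sym (basis-bound i)) (IsBasis.member isBasis i))
    all-fixed : ∀ v → A · v ≋ v
    all-fixed v i = *-cancelˡ nondegenerate (begin
      δ *ᴿ (A · v) i                                    ≈⟨ L.homo-* δ v ⟨
      (A · (δ *ⱽ v)) i                                  ≈⟨ L.cong (cramer basis v) ⟩
      (A · linComb a basis) i                           ≈⟨ L.homo-linComb a basis ⟩
      ∑[ j < n ] (a j *ᴿ (A · basis j) i)
        ≈⟨ sum-cong-≋ (λ j → R.*-congˡ {a j} (basis-fixed j (cover j) i)) ⟩
      linComb a basis i                                 ≈⟨ cramer basis v i ⟨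
      δ *ᴿ v i                                          ∎)
      where
      open ≈-Reasoning R.setoid
      a = λ j → volume (basis [ j ≔ v ])
      module L = IsLinear (·-linear A i)
    entry : A i j ≃ 1ᴹ i j
    entry = R.trans (R.sym (·1ᴹ-identity (A i) j)) (all-fixed (λ l → 1ᴹ l j) i)

-- From the generators to the stabilizer subgroups

generated⇒det≃1 : {S : GL n → Set} → (∀ {g} → S g → det (mat g) ≃ 1ᴿ) →
  ∀ {g} → Generated (GL-group n) S g → det (mat g) ≃ 1ᴿ
generated⇒det≃1 S⇒1 (∈-gen s)                = S⇒1 s
generated⇒det≃1 {n} S⇒1 ε-gen                = det-1ᴹ {n}
generated⇒det≃1 S⇒1 (∙-gen {g} {h} p q)      = R.trans (det-* (mat g) (mat h))
  (R.trans (R.*-cong (generated⇒det≃1 S⇒1 p) (generated⇒det≃1 S⇒1 q)) (R.*-identityˡ 1ᴿ))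
generated⇒det≃1 {n} S⇒1 (⁻¹-gen {g} p)       = begin
  det (inv g)                      ≈⟨ R.*-identityʳ _ ⟨
  det (inv g) *ᴿ 1ᴿ                ≈⟨ R.*-congˡ (generated⇒det≃1 S⇒1 p) ⟨
  det (inv g) *ᴿ det (mat g)       ≈⟨ det-* (inv g) (mat g) ⟨
  det (inv g *ᴹ mat g)             ≈⟨ det-cong (inverseˡ g) ⟩
  det (1ᴹ {n})                     ≈⟨ det-1ᴹ {n} ⟩
  1ᴿ                               ∎
  where open ≈-Reasoning R.setoid
generated⇒det≃1 S⇒1 (≈-gen g≈h p)            = R.trans (R.sym (det-cong g≈h)) (generated⇒det≃1 S⇒1 p)

proposition4p2 : (n : ℕ) (G : Subgroup (GL-group n)) →
    IsFinite G → StrictlyGeneratedInCodim2 G → Empty (𝒜₁ G)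
proposition4p2 n G finite (generated , _) W ((H , (H⊆ , _) , nontrivial , W⊆V^H , _) , codim) =
  nontrivial (trivial , λ g≈ε → Subgroup.resp H (λ i j → R.sym (g≈ε i j)) (Subgroup.ε-closed H))
  where
  det≃1 : ∀ {g} → g ∈ ⟦ G ⟧ᴳ → det (mat g) ≃ 1ᴿ
  det≃1 g∈G = generated⇒det≃1
    (λ {g} (g∈G , codim2) → codim2⇒det≃1 g (finite⇒finiteOrder G g∈G finite) codim2) (generated g∈G)
  trivial : ∀ {h} → h ∈ ⟦ H ⟧ᴳ → mat h ≃ᴹ 1ᴹ
  trivial {h} h∈H = codim1-det≃1⇒≈1 (mat h) (finite⇒finiteOrder G (proj₁ (H⊆ h∈H)) finite) codim
    (λ w∈W → W⊆V^H w∈W h h∈H) (det≃1 (proj₁ (H⊆ h∈H)))
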